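{- Let $m,n\ge 1$, let $T=(V_T,E_T)$ be any tree on $m$ vertices, let $v'$ be any vertex in $V_T$, and let $K$ be the complete graph on $n$ vertices. Then all orbits of toric promotion on the corona product $K\odot T(v')$ have length $(nm+n)(nm+n-1)$.
   Context: Toric promotion. Let $G=(V,E)$ be a finite simple graph (undirected, no loops, no multiple edges) on $N$ vertices. A labeling of $G$ is a bijection $\sigma:V\to\mathbb{Z}/N\mathbb{Z}=\{1,\dots,N\}$ (addition modulo $N$). A state is a pair $(\sigma,i)$ with $\sigma$ a labeling of $G$ and $i\in\mathbb{Z}/N\mathbb{Z}$; $\Omega_G$ is the set of all states. Toric promotion is the map $\mathrm{TPro}:\Omega_G\to\Omega_G$ given by $\mathrm{TPro}(\sigma,i)=(\sigma,i+1)$ if $\{\sigma^{ -1}(i),\sigma^{ -1}(i+1)\}\in E$, and $\mathrm{TPro}(\sigma,i)=((i,i+1)\circ\sigma,\,i+1)$ otherwise, where $(i,i+1)$ is the permutation of $\mathbb{Z}/N\mathbb{Z}$ swapping $i$ and $i+1$. It is a bijection of $\Omega_G$. The length of the orbit containing $(\sigma,i)$ is the least $L\ge 1$ with $\mathrm{TPro}^L(\sigma,i)=(\sigma,i)$. Corona product. Let $G_1=(V_1,E_1)$ and $G_2=(V_2,E_2)$ be graphs with $V_1=\{v_1,\dots,v_\nu\}$, and let $v'\in V_2$. The corona product $G_1\odot G_2(v')$ is the graph obtained from $G_1$ together with $\nu$ pairwise disjoint copies ${}^1G_2,\dots,{}^\nu G_2$ of $G_2$ (disjoint from $G_1$) by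 adding, for every $i\in\{1,\dots,\nu\}$, the edge $\{v_i,v'_i\}$, where $v'_i$ is the copy of $v'$ in ${}^iG_2$. -}

module Defs where

open import Data.Fin.Base using (Fin; toℕ)
open import Data.Fin.Permutation using (transpose)
open import Data.Fin.Properties using (_≟_; nonZeroIndex; +↔⊎; *↔×)
open import Data.List.Base using (List; _∷_; _∷ʳ_; length)
open import Data.List.Relation.Unary.Linked using (Linked)
open import Data.List.Relation.Unary.Unique.Propositional using (Unique)
open import Data.Nat.Base using (ℕ; suc; _+_; _*_; _≤_)
open import Data.Nat.DivMod using (_mod_)
open import Data.Nat.GeneralisedArithmetic using (iterate)
open import Data.Product.Base using (_×_; _,_)
open import Data.Product.Function.NonDependent.Propositional using (_×-↔_)
open import Data.Sum.Base using (_⊎_; inj₁; inj₂)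
open import Data.Sum.Function.Propositional using (_⊎-↔_)
open import Function.Bundles using (_↔_; Inverse)
open import Function.Properties.Inverse using (↔-refl; ↔-sym; ↔-trans; ↔⇒↣)
open import Relation.Binary.Construct.Closure.ReflexiveTransitive using (Star)
open import Relation.Binary.Definitions using (Decidable; DecidableEquality; Symmetric)
open import Relation.Binary.PropositionalEquality.Core using (_≡_; _≢_; _≗_; refl; sym; ≢-sym)
open import Relation.Nullary.Decidable using (yes; no; ¬?; _×-dec_; via-injection)
open import Relation.Nullary.Negation using (¬_)

-- The index is the number of vertices.  Adjacency is decidable because toric
-- promotion branches on it.
record Graph (N : ℕ) : Set₁ where
  infix 4 _~_ _~?_
  field
    V        : Set
    finite   : V ↔ Fin N
    _~_      : V → V → Set
    _~?_     : Decidable _~_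
    ~-sym    : Symmetric _~_
    ~-irrefl : ∀ {v} → ¬ (v ~ v)

  infix 4 _≟ᵥ_
  _≟ᵥ_ : DecidableEquality V
  _≟ᵥ_ = via-injection (↔⇒↣ finite) _≟_

open Graph using (V)

complete : ∀ n → Graph n
complete n = record
  { V        = Fin n
  ; finite   = ↔-refl
  ; _~_      = _≢_
  ; _~?_     = λ i j → ¬? (i ≟ j)
  ; ~-sym    = ≢-sym
  ; ~-irrefl = λ v≢v → v≢v refl
  }

module _ {N : ℕ} (G : Graph N) where
  open Graph G using (_~_)

  Connected : Set
  Connected = ∀ u v → Star _~_ u v

  -- v ∷ vs lists the vertices of a cycle of length at least 3, each once; the
  -- closing edge joins the last vertex of vs to v.
  IsCycle : V G → List (V G) → Set
  IsCycle v vs = 2 ≤ length vs × Unique (v ∷ vs) × Linked _~_ (v ∷ (vs ∷ʳ v))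

  Acyclic : Set
  Acyclic = ∀ v vs → ¬ IsCycle v vs

  IsTree : Set
  IsTree = Connected × Acyclic

-- inj₁ u is the vertex u of G₁, and inj₂ (u , x) is the copy of the vertex x in
-- the copy of G₂ attached to u.
module Corona {ν μ : ℕ} (G₁ : Graph ν) (G₂ : Graph μ) (v′ : V G₂) where
  private
    module G₁ = Graph G₁
    module G₂ = Graph G₂

  Vertex : Set
  Vertex = G₁.V ⊎ (G₁.V × G₂.V)

  Adj : Vertex → Vertex → Set
  Adj (inj₁ u)       (inj₁ w)       = u G₁.~ w
  Adj (inj₁ u)       (inj₂ (w , y)) = u ≡ w × y ≡ v′
  Adj (inj₂ (u , x)) (inj₁ w)       = u ≡ w × x ≡ v′
  Adj (inj₂ (u , x)) (inj₂ (w , y)) = u ≡ w × x G₂.~ y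

  adj? : Decidable Adj
  adj? (inj₁ u)       (inj₁ w)       = u G₁.~? w
  adj? (inj₁ u)       (inj₂ (w , y)) = (u G₁.≟ᵥ w) ×-dec (y G₂.≟ᵥ v′)
  adj? (inj₂ (u , x)) (inj₁ w)       = (u G₁.≟ᵥ w) ×-dec (x G₂.≟ᵥ v′)
  adj? (inj₂ (u , x)) (inj₂ (w , y)) = (u G₁.≟ᵥ w) ×-dec (x G₂.~? y)

  adj-sym : Symmetric Adj
  adj-sym {inj₁ _} {inj₁ _} u~w         = G₁.~-sym u~w
  adj-sym {inj₁ _} {inj₂ _} (u≡w , y≡v) = sym u≡w , y≡v
  adj-sym {inj₂ _} {inj₁ _} (u≡w , x≡v) = sym u≡w , x≡v
  adj-sym {inj₂ _} {inj₂ _} (u≡w , x~y) = sym u≡w , G₂.~-sym x~y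

  adj-irrefl : ∀ {p} → ¬ Adj p p
  adj-irrefl {inj₁ _} u~u       = G₁.~-irrefl u~u
  adj-irrefl {inj₂ _} (_ , x~x) = G₂.~-irrefl x~x

  corona : Graph (ν + ν * μ)
  corona = record
    { V        = Vertex
    ; finite   = ↔-trans (G₁.finite ⊎-↔ ↔-trans (G₁.finite ×-↔ G₂.finite) (↔-sym *↔×))
                         (↔-sym +↔⊎)
    ; _~_      = Adj
    ; _~?_     = adj?
    ; ~-sym    = λ {p} {q} → adj-sym {p} {q}
    ; ~-irrefl = λ {p} → adj-irrefl {p}
    }

infix 8 _⊙_⟨_⟩
_⊙_⟨_⟩ : ∀ {ν μ} (G₁ : Graph ν) (G₂ : Graph μ) → V G₂ → Graph (ν + ν * μ)
G₁ ⊙ G₂ ⟨ v′ ⟩ = Corona.corona G₁ G₂ v′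

-- i ↦ i + 1 in ℤ/Nℤ, whose elements are represented by 0, …, N - 1.
next : ∀ {N} → Fin N → Fin N
next {N} i = (suc (toℕ i) mod N) {{nonZeroIndex i}}

module _ {N : ℕ} (G : Graph N) where
  open Graph G using (_~?_)

  Labeling : Set
  Labeling = V G ↔ Fin N

  State : Set
  State = Labeling × Fin N

  -- Labelings are compared as functions: propositional equality of _↔_ would
  -- also compare the proofs it carries, and needs function extensionality.
  infix 4 _≈_
  _≈_ : State → State → Set
  (σ , i) ≈ (τ , j) = Inverse.to σ ≗ Inverse.to τ × i ≡ j

  TPro : State → State
  TPro (σ , i) with Inverse.from σ i ~? Inverse.from σ (next i)
  ... | yes _ = σ , next i
  ... | no  _ = ↔-trans σ (transpose i (next i)) , next i

  record OrbitLength (s : State) (L : ℕ) : Set where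
    field
      positive : 1 ≤ L
      returns  : iterate TPro s L ≈ s
      least    : ∀ k → 1 ≤ k → iterate TPro s k ≈ s → L ≤ k

{-# OPTIONS --safe #-}

-- Watch the vertex h held at the pointer.  The other M = N - 1 vertices form a
-- queue, that is M slots with a cyclic pointer p; a step exchanges h with the
-- content of the slot p if the two are adjacent, and advances p.  Let K be the
-- clique and X the set of all tree vertices, each x ∈ X with a parent up x.
--
-- * The edge {x , up x} owns a slot once and for all, which always contains the
--   endpoint farther from h.  At this slot h moves along the edge if it is one
--   of the endpoints.
-- * The remaining slots, the holes, contain the vertices of K other than the root
--   of the tree of h, in a fixed cyclic order κ.  At a hole, h ∈ K moves to κ h.
--
-- So the state is a function of (h , p), and toric promotion becomes a permutation
-- of the N * M pairs.  An excursion from up x to x comes back through the slot of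
-- {x , up x}, and a full turn inside K amounts to κ⁻¹ because there is one hole
-- fewer than there are vertices in K; hence the permutation is a single cycle.
-- Finally p is recovered from the state whenever h ∈ K is about to descend into a
-- tree, so no state recurs earlier.
module Submission where

open import Defs
open import Data.Fin.Base using (Fin; zero; suc; toℕ; fromℕ<)
open import Data.Fin.Permutation.Components as PC using ()
open import Data.Fin.Properties as Fin
  using (toℕ-injective; toℕ-fromℕ<; toℕ<n; pigeonhole; injective⇒≤; *↔×)
open import Data.List.Base using (List; []; _∷_; _∷ʳ_; length)
open import Data.List.Membership.Propositional using (_∈_; _∉_)
open import Data.List.Properties using (∷-injectiveʳ)
open import Data.List.Relation.Unary.All using ([]; _∷_)
open import Data.List.Relation.Unary.All.Properties using (¬Any⇒All¬; All¬⇒¬Any)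
open import Data.List.Relation.Unary.AllPairs using ([]; _∷_)
open import Data.List.Relation.Unary.Any using (here; there; any?)
open import Data.List.Relation.Unary.Linked using (Linked; [-]; _∷_)
open import Data.List.Relation.Unary.Unique.Propositional using (Unique)
open import Data.Maybe.Base using (Maybe; just; nothing)
open import Data.Maybe.Properties using (just-injective)
open import Data.Nat.Base using (ℕ; zero; suc; _+_; _*_; _∸_; _≤_; _<_; z≤n; s≤s)
open import Data.Nat.DivMod
  using (_%_; _/_; m%n<n; m%n%n≡m%n; [m+n]%n≡m%n; m<n⇒m%n≡m; %-distribˡ-+; m≡m%n+[m/n]*n)
open import Data.Nat.GeneralisedArithmetic using (iterate)
open import Data.Nat.Induction using (<-wellFounded)
open import Data.Nat.Properties
  using (*-comm; *-mono-≤; *-suc; +-assoc; +-comm; +-identityʳ; +-mono-≤; +-monoʳ-<;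
        +-monoˡ-≤; +-suc; <-cmp; <-trans; <-≤-trans; <⇒≢; <⇒≤; <⇒≱; m+[n∸m]≡n;
        m<1+n⇒m<n∨m≡n; m<n⇒0<n∸m; m<n⇒m<1+n; m∸n+n≡m; m∸n≤m; m≤m+n; m≤n+m; m≤n⇒m≤o+n;
        ≤-<-trans; ≤-antisym; ≤-pred; ≤-refl; ≤-reflexive; ≤-trans)
open import Data.Product.Base using (∃; _×_; _,_; proj₁; proj₂)
open import Data.Product.Function.NonDependent.Propositional using (_×-↔_)
open import Data.Sum.Base using (_⊎_; inj₁; inj₂)
open import Data.Sum.Properties using (inj₁-injective; inj₂-injective)
open import Function.Base using (_∘_)
open import Function.Bundles using (_↔_; Inverse; mk⤖)
open import Function.Consequences.Propositional using (strictlySurjective⇒surjective)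
open import Function.Definitions using (Injective; StrictlySurjective)
open import Function.Properties.Bijection using (⤖⇒↔)
open import Function.Properties.Inverse using (↔-refl; ↔-sym; ↔-trans)
open import Induction.WellFounded using (Acc; acc)
open import Relation.Binary.Construct.Closure.ReflexiveTransitive as Star using (Star; ε; _◅_; _◅◅_)
open import Relation.Binary.Definitions using (Decidable; DecidableEquality; Symmetric; tri<; tri≈; tri>)
open import Relation.Binary.PropositionalEquality
open import Relation.Nullary.Decidable using (Dec; yes; no; map′)
open import Relation.Nullary.Negation using (¬_; contradiction)

-- Orbits of a permutation

module _ {A : Set} (f : A → A) where

  iterate-suc : ∀ x k → iterate f (f x) k ≡ f (iterate f x k)
  iterate-suc x zero    = refl
  iterate-suc x (suc k) = iterate-suc (f x) k

  iterate-+ : ∀ x j k → iterate f x (j + k) ≡ iterate f (iterate f x j) k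
  iterate-+ x zero    k = refl
  iterate-+ x (suc j) k = iterate-+ (f x) j k

  iterate-comm : ∀ x j k → iterate f (iterate f x j) k ≡ iterate f (iterate f x k) j
  iterate-comm x j k = begin
    iterate f (iterate f x j) k ≡⟨ iterate-+ x j k ⟨
    iterate f x (j + k)         ≡⟨ cong (iterate f x) (+-comm j k) ⟩
    iterate f x (k + j)         ≡⟨ iterate-+ x k j ⟩
    iterate f (iterate f x k) j ∎
    where open ≡-Reasoning

  iterate-periodic : ∀ x k → iterate f x k ≡ x → ∀ j → iterate f x (j * k) ≡ x
  iterate-periodic x k fᵏx≡x zero    = refl
  iterate-periodic x k fᵏx≡x (suc j) = begin
    iterate f x (k + j * k)           ≡⟨ iterate-+ x k (j * k) ⟩
    iterate f (iterate f x k) (j * k) ≡⟨ cong (λ y → iterate f y (j * k)) fᵏx≡x ⟩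
    iterate f x (j * k)               ≡⟨ iterate-periodic x k fᵏx≡x j ⟩
    x                                 ∎
    where open ≡-Reasoning

  iterate-injective : Injective _≡_ _≡_ f → ∀ k → Injective _≡_ _≡_ (λ x → iterate f x k)
  iterate-injective inj zero    eq = eq
  iterate-injective inj (suc k) eq = inj (iterate-injective inj k eq)

  -- Letting forward iterates of both points meet makes symmetry immediate, with no inverse of `f`.
  SameOrbit : A → A → Set
  SameOrbit x y = ∃ λ i → ∃ λ j → iterate f x i ≡ iterate f y j

  same-refl : ∀ {x} → SameOrbit x x
  same-refl = 0 , 0 , refl

  same-sym : ∀ {x y} → SameOrbit x y → SameOrbit y x
  same-sym (i , j , eq) = j , i , sym eq

  same-trans : ∀ {x y z} → SameOrbit x y → SameOrbit y z → SameOrbit x z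
  same-trans {x} {y} {z} (i , j , p) (k , l , q) = i + k , l + j , (begin
    iterate f x (i + k)         ≡⟨ iterate-+ x i k ⟩
    iterate f (iterate f x i) k ≡⟨ cong (λ w → iterate f w k) p ⟩
    iterate f (iterate f y j) k ≡⟨ iterate-comm y j k ⟩
    iterate f (iterate f y k) j ≡⟨ cong (λ w → iterate f w j) q ⟩
    iterate f (iterate f z l) j ≡⟨ iterate-+ z l j ⟨
    iterate f z (l + j)         ∎)
    where open ≡-Reasoning

  same-step : ∀ {x y} → f x ≡ y → SameOrbit x y
  same-step eq = 1 , 0 , eq

module SingleOrbit {A : Set} {L : ℕ} (A↔Fin : A ↔ Fin L) (f : A → A)
  (f-injective : Injective _≡_ _≡_ f) (connected : ∀ x y → SameOrbit f x y) where

  private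
    enc : A → Fin L
    enc = Inverse.to A↔Fin

    enc-injective : Injective _≡_ _≡_ enc
    enc-injective {x} {y} eq = trans (sym (Inverse.strictlyInverseʳ A↔Fin x))
      (trans (cong (Inverse.from A↔Fin) eq) (Inverse.strictlyInverseʳ A↔Fin y))

  -- Connectedness only makes two orbits meet; full periods at `x` supply the steps needed to cancel
  -- those taken from `y`, and the count is then reduced modulo the period.
  reachable : ∀ x k → 1 ≤ k → iterate f x k ≡ x → ∀ y → ∃ λ i → i < k × iterate f x i ≡ y
  reachable x (suc k) _ fᵏx≡x y with connected x y
  ... | i , j , fⁱx≡fʲy = i′ % suc k , m%n<n i′ (suc k) , trans eq′ eq
    where
    open ≡-Reasoning
    -- This is `i + j * suc k` less `j`: `j` full periods are added before `j` steps are taken off.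
    i′ = i + j * k
    eq : iterate f x i′ ≡ y
    eq = iterate-injective f f-injective j (begin
      iterate f (iterate f x (i + j * k)) j   ≡⟨ iterate-+ f x (i + j * k) j ⟨
      iterate f x (i + j * k + j)             ≡⟨ cong (iterate f x) (+-assoc i (j * k) j) ⟩
      iterate f x (i + (j * k + j))           ≡⟨ cong (λ t → iterate f x (i + t)) (trans (+-comm (j * k) j) (sym (*-suc j k))) ⟩
      iterate f x (i + j * suc k)             ≡⟨ cong (iterate f x) (+-comm i _) ⟩
      iterate f x (j * suc k + i)             ≡⟨ iterate-+ f x (j * suc k) i ⟩
      iterate f (iterate f x (j * suc k)) i   ≡⟨ cong (λ w → iterate f w i) (iterate-periodic f x (suc k) fᵏx≡x j) ⟩
      iterate f x i                           ≡⟨ fⁱx≡fʲy ⟩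
      iterate f y j                           ∎)
    eq′ : iterate f x (i′ % suc k) ≡ iterate f x i′
    eq′ = begin
      iterate f x (i′ % suc k)
        ≡⟨ cong (λ w → iterate f w (i′ % suc k)) (iterate-periodic f x (suc k) fᵏx≡x (i′ / suc k)) ⟨
      iterate f (iterate f x (i′ / suc k * suc k)) (i′ % suc k)
        ≡⟨ iterate-+ f x (i′ / suc k * suc k) (i′ % suc k) ⟨
      iterate f x (i′ / suc k * suc k + i′ % suc k)
        ≡⟨ cong (iterate f x) (trans (+-comm _ (i′ % suc k)) (sym (m≡m%n+[m/n]*n i′ (suc k)))) ⟩
      iterate f x i′ ∎

  -- All `L` points occur among the first `k` iterates, which injects `Fin L` into `Fin k`.
  period≥L : ∀ x k → 1 ≤ k → iterate f x k ≡ x → L ≤ k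
  period≥L x k 1≤k fᵏx≡x = injective⇒≤ {f = index} index-injective
    where
    r : ∀ y → ∃ λ i → i < k × iterate f x i ≡ y
    r = reachable x k 1≤k fᵏx≡x
    dec = Inverse.from A↔Fin
    index : Fin L → Fin k
    index a = fromℕ< (proj₁ (proj₂ (r (dec a))))
    index-injective : Injective _≡_ _≡_ index
    index-injective {a} {b} eq = begin
      a           ≡⟨ Inverse.strictlyInverseˡ A↔Fin a ⟨
      enc (dec a) ≡⟨ cong enc dec≡ ⟩
      enc (dec b) ≡⟨ Inverse.strictlyInverseˡ A↔Fin b ⟩
      b           ∎
      where
      open ≡-Reasoning
      i≡ : proj₁ (r (dec a)) ≡ proj₁ (r (dec b))
      i≡ = trans (sym (toℕ-fromℕ< (proj₁ (proj₂ (r (dec a))))))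
                 (trans (cong toℕ eq) (toℕ-fromℕ< (proj₁ (proj₂ (r (dec b))))))
      dec≡ : dec a ≡ dec b
      dec≡ = trans (sym (proj₂ (proj₂ (r (dec a)))))
                   (trans (cong (iterate f x) i≡) (proj₂ (proj₂ (r (dec b)))))

  -- Two of the first `L + 1` iterates coincide and give a period of at most `L`; `period≥L`
  -- excludes a smaller one.
  periodic : ∀ x → iterate f x L ≡ x
  periodic x with pigeonhole {m = L} {n = suc L} ≤-refl (λ i → enc (iterate f x (toℕ i)))
  ... | i , j , i<j , eq = subst (λ d → iterate f x d ≡ x) d≡L fᵈx≡x
    where
    open ≡-Reasoning
    d = toℕ j ∸ toℕ i
    fᵈx≡x : iterate f x d ≡ x
    fᵈx≡x = iterate-injective f f-injective (toℕ i) (begin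
      iterate f (iterate f x d) (toℕ i) ≡⟨ iterate-+ f x d (toℕ i) ⟨
      iterate f x (d + toℕ i)           ≡⟨ cong (iterate f x) (m∸n+n≡m (<⇒≤ i<j)) ⟩
      iterate f x (toℕ j)               ≡⟨ enc-injective eq ⟨
      iterate f x (toℕ i)               ∎)
    d≤L : d ≤ L
    d≤L = ≤-trans (m∸n≤m (toℕ j) (toℕ i)) (≤-pred (toℕ<n j))
    d≡L : d ≡ L
    d≡L = ≤-antisym d≤L (period≥L x d (m<n⇒0<n∸m i<j) fᵈx≡x)

-- The cyclic successor on Fin

module _ {n : ℕ} where

  private N = suc n

  [m%n+o]%n≡[m+o]%n : ∀ m o → (m % N + o) % N ≡ (m + o) % N
  [m%n+o]%n≡[m+o]%n m o = begin
    (m % N + o) % N         ≡⟨ %-distribˡ-+ (m % N) o N ⟩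
    (m % N % N + o % N) % N ≡⟨ cong (λ t → (t + o % N) % N) (m%n%n≡m%n m N) ⟩
    (m % N + o % N) % N     ≡⟨ %-distribˡ-+ m o N ⟨
    (m + o) % N             ∎
    where open ≡-Reasoning

  toℕ-next : ∀ (i : Fin N) → toℕ (next i) ≡ suc (toℕ i) % N
  toℕ-next i = toℕ-fromℕ< (m%n<n (suc (toℕ i)) N)

  toℕ-next^ : ∀ (i : Fin N) k → toℕ (iterate next i k) ≡ (toℕ i + k) % N
  toℕ-next^ i zero    = sym (trans (cong (_% N) (+-identityʳ (toℕ i))) (m<n⇒m%n≡m (toℕ<n i)))
  toℕ-next^ i (suc k) = begin
    toℕ (iterate next (next i) k) ≡⟨ toℕ-next^ (next i) k ⟩
    (toℕ (next i) + k) % N        ≡⟨ cong (λ t → (t + k) % N) (toℕ-next i) ⟩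
    (suc (toℕ i) % N + k) % N     ≡⟨ [m%n+o]%n≡[m+o]%n (suc (toℕ i)) k ⟩
    (suc (toℕ i) + k) % N         ≡⟨ cong (_% N) (+-suc (toℕ i) k) ⟨
    (toℕ i + suc k) % N           ∎
    where open ≡-Reasoning

  next^N : ∀ (i : Fin N) → iterate next i N ≡ i
  next^N i = toℕ-injective (trans (toℕ-next^ i N)
    (trans ([m+n]%n≡m%n (toℕ i) N) (m<n⇒m%n≡m (toℕ<n i))))

  next-injective : Injective _≡_ _≡_ (next {N})
  next-injective {i} {j} eq =
    trans (sym (next^N i)) (trans (cong (λ k → iterate next k n) eq) (next^N j))

  -- The least number of steps of `next` from `i` to `j`; `N ∸ toℕ i` stands for minus `i` modulo
  -- `N`.
  dist : Fin N → Fin N → ℕ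
  dist i j = (toℕ j + (N ∸ toℕ i)) % N

  dist<N : ∀ i j → dist i j < N
  dist<N i j = m%n<n (toℕ j + (N ∸ toℕ i)) N

  next^dist : ∀ i j → iterate next i (dist i j) ≡ j
  next^dist i j = toℕ-injective (begin
    toℕ (iterate next i (dist i j))         ≡⟨ toℕ-next^ i (dist i j) ⟩
    (a + (b + (N ∸ a)) % N) % N             ≡⟨ cong (_% N) (+-comm a _) ⟩
    ((b + (N ∸ a)) % N + a) % N             ≡⟨ [m%n+o]%n≡[m+o]%n (b + (N ∸ a)) a ⟩
    (b + (N ∸ a) + a) % N                   ≡⟨ cong (_% N) (trans (+-assoc b _ a) (cong (b +_) (m∸n+n≡m (<⇒≤ (toℕ<n i))))) ⟩
    (b + N) % N                             ≡⟨ [m+n]%n≡m%n b N ⟩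
    b % N                                   ≡⟨ m<n⇒m%n≡m (toℕ<n j) ⟩
    b                                       ∎)
    where
    open ≡-Reasoning
    a = toℕ i
    b = toℕ j

  dist-next^ : ∀ i {k} → k < N → dist i (iterate next i k) ≡ k
  dist-next^ i {k} k<N = begin
    (toℕ (iterate next i k) + (N ∸ a)) % N ≡⟨ cong (λ t → (t + (N ∸ a)) % N) (toℕ-next^ i k) ⟩
    ((a + k) % N + (N ∸ a)) % N            ≡⟨ [m%n+o]%n≡[m+o]%n (a + k) (N ∸ a) ⟩
    (a + k + (N ∸ a)) % N                  ≡⟨ cong (λ t → (t + (N ∸ a)) % N) (+-comm a k) ⟩
    (k + a + (N ∸ a)) % N                  ≡⟨ cong (_% N) (trans (+-assoc k a _) (cong (k +_) (m+[n∸m]≡n (<⇒≤ (toℕ<n i))))) ⟩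
    (k + N) % N                            ≡⟨ [m+n]%n≡m%n k N ⟩
    k % N                                  ≡⟨ m<n⇒m%n≡m k<N ⟩
    k                                      ∎
    where
    open ≡-Reasoning
    a = toℕ i

  dist-unique : ∀ i {j k} → k < N → iterate next i k ≡ j → dist i j ≡ k
  dist-unique i k<N eq = trans (cong (dist i) (sym eq)) (dist-next^ i k<N)

  next^-injective : ∀ i {j k} → j < N → k < N → iterate next i j ≡ iterate next i k → j ≡ k
  next^-injective i j<N k<N eq = trans (sym (dist-next^ i j<N)) (dist-unique i k<N (sym eq))

  dist-self : ∀ i → dist i i ≡ 0
  dist-self i = dist-unique i (s≤s z≤n) refl

  dist-pred : ∀ i → dist (next i) i ≡ n
  dist-pred i = dist-unique (next i) ≤-refl (next^N i)

  dist-suc : ∀ {i j} → i ≢ j → dist i j ≡ suc (dist (next i) j)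
  dist-suc {i} {j} i≢j with dist i j in eq | next^dist i j | dist<N i j
  ... | zero  | i≡j   | _    = contradiction i≡j i≢j
  ... | suc k | next≡ | sk<N = cong suc (sym (dist-unique (next i) (<⇒≤ sk<N) next≡))

-- Rooted trees

module SimplePaths {N : ℕ} (G : Graph N) where
  open Graph G

  data SimplePath (z : V) : V → List V → Set where
    stop : SimplePath z z (z ∷ [])
    step : ∀ {x y l} → x ~ y → SimplePath z y l → x ∉ l → SimplePath z x (x ∷ l)

  start∈ : ∀ {z x l} → SimplePath z x l → x ∈ l
  start∈ stop         = here refl
  start∈ (step _ _ _) = here refl

  end∈ : ∀ {z x l} → SimplePath z x l → z ∈ l
  end∈ stop         = here refl
  end∈ (step _ p _) = there (end∈ p)

  starts-equal : ∀ {z x y l} → SimplePath z x l → SimplePath z y l → x ≡ y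
  starts-equal stop         stop         = refl
  starts-equal stop         (step _ _ _) = refl
  starts-equal (step _ _ _) stop         = refl
  starts-equal (step _ _ _) (step _ _ _) = refl

  Avoiding : V → V → V → Set
  Avoiding a x y = x ~ y × a ≢ x × a ≢ y

  avoiding-sym : ∀ {a x y} → Avoiding a x y → Avoiding a y x
  avoiding-sym (x~y , a≢x , a≢y) = ~-sym x~y , a≢y , a≢x

  suffix : ∀ {z x y l} → SimplePath z y l → x ∈ l → ∃ λ l′ → SimplePath z x l′ × (∀ {a} → a ∉ l → a ∉ l′)
  suffix p@stop         (here refl)  = _ , p , λ a∉ → a∉
  suffix p@(step _ _ _) (here refl)  = _ , p , λ a∉ → a∉
  suffix (step _ p _)   (there x∈l) with suffix p x∈l
  ... | l′ , p′ , sub = l′ , p′ , λ a∉ → sub (a∉ ∘ there)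

  erase-loops : ∀ {a x z} → a ≢ z → Star (Avoiding a) x z → ∃ λ l → SimplePath z x l × a ∉ l
  erase-loops a≢z ε = _ , stop , λ { (here a≡z) → a≢z a≡z }
  erase-loops {x = x} a≢z ((x~y , a≢x , _) ◅ w) with erase-loops a≢z w
  ... | l , p , a∉l with any? (x ≟ᵥ_) l
  ...   | no x∉l  = x ∷ l , step x~y p x∉l , λ { (here a≡x) → a≢x a≡x ; (there a∈l) → a∉l a∈l }
  ...   | yes x∈l with suffix p x∈l
  ...     | l′ , p′ , sub = l′ , p′ , sub a∉l

  simple-path : ∀ {x z} → Star _~_ x z → ∃ λ l → SimplePath z x l
  simple-path ε = _ , stop
  simple-path {x} (x~y ◅ w) with simple-path w
  ... | l , p with any? (x ≟ᵥ_) l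
  ...   | no x∉l  = x ∷ l , step x~y p x∉l
  ...   | yes x∈l with suffix p x∈l
  ...     | l′ , p′ , _ = l′ , p′

  walk-to : ∀ {a x y z l} → SimplePath z y l → a ∉ l → x ∈ l → Star (Avoiding a) y x
  walk-to stop           a∉ (here refl) = ε
  walk-to (step _ _ _)   a∉ (here refl) = ε
  walk-to (step y~w p _) a∉ (there x∈l) = (y~w , a∉ ∘ here , λ { refl → a∉ (there (start∈ p)) }) ◅ walk-to p (a∉ ∘ there) x∈l

  unique : ∀ {z x l} → SimplePath z x l → Unique l
  unique stop           = [] ∷ []
  unique (step _ p x∉l) = ¬Any⇒All¬ _ x∉l ∷ unique p

  linked-closing : ∀ {x y z a l} → a ~ x → SimplePath z x l → z ~ y → Linked _~_ (a ∷ (l ∷ʳ y))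
  linked-closing a~x stop           z~y = a~x ∷ z~y ∷ [-]
  linked-closing a~x (step x~w p _) z~y = a~x ∷ linked-closing x~w p z~y

  module _ (acyclic : Acyclic G) where

    -- Freed of loops, the walk is a simple path that closes up through `x` to a cycle unless it is
    -- trivial.
    no-bypass : ∀ {x y z} → x ~ y → x ~ z → Star (Avoiding x) y z → y ≡ z
    no-bypass {x} {y} {z} x~y x~z w with erase-loops (λ { refl → ~-irrefl x~z }) w
    ... | _ , stop , _ = refl
    ... | l , p@(step _ q _) , x∉l = contradiction
      (2≤ q , (¬Any⇒All¬ _ x∉l ∷ unique p) , linked-closing x~y p (~-sym x~z)) (acyclic x l)
      where
      2≤ : ∀ {y l} → SimplePath z y l → 2 ≤ suc (length l)
      2≤ stop         = s≤s (s≤s z≤n)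
      2≤ (step _ _ _) = s≤s (s≤s z≤n)

    -- Both remainders avoid `x` and end at `z`, so together they join the two successors of `x` by
    -- a walk to which `no-bypass` applies.
    simple-path-unique : ∀ {z x l l′} → SimplePath z x l → SimplePath z x l′ → l ≡ l′
    simple-path-unique stop           stop           = refl
    simple-path-unique stop           (step _ q x∉l) = contradiction (end∈ q) x∉l
    simple-path-unique (step _ p x∉l) stop           = contradiction (end∈ p) x∉l
    simple-path-unique (step x~y p x∉l) (step x~y′ q x∉l′)
      with no-bypass x~y x~y′ (walk-to p x∉l (end∈ p) ◅◅ Star.reverse avoiding-sym (walk-to q x∉l′ (end∈ q)))
    ... | refl = cong (_ ∷_) (simple-path-unique p q)

-- Parents in a tree with root `r`

module Rooted {N : ℕ} (T : Graph N) (tree : IsTree T) (r : Graph.V T) where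
  open Graph T
  open SimplePaths T

  private
    acyclic = proj₂ tree

    ancestors : V → List V
    ancestors x = proj₁ (simple-path (proj₁ tree x r))

    ancestors-path : ∀ x → SimplePath r x (ancestors x)
    ancestors-path x = proj₂ (simple-path (proj₁ tree x r))

  -- The root is its own parent, a default value that keeps `parent` total.
  data IsParent (x : V) : V → Set where
    root  : x ≡ r → IsParent x r
    above : ∀ {y} → x ≢ r → x ~ y → ancestors x ≡ x ∷ ancestors y → IsParent x y

  find-parent : ∀ x → ∃ (IsParent x)
  find-parent x with ancestors x in eq | ancestors-path x
  ... | _ | stop             = r , root refl
  ... | _ | step {y = y} x~y p x∉l = y , above (λ { refl → x∉l (end∈ p) }) x~y
    (trans eq (cong (x ∷_) (simple-path-unique acyclic p (ancestors-path y))))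

  parent : V → V
  parent x = proj₁ (find-parent x)

  depth : V → ℕ
  depth x = length (ancestors x)

  parent-adj : ∀ {x} → x ≢ r → x ~ parent x
  parent-adj {x} x≢r with find-parent x
  ... | _ , root x≡r      = contradiction x≡r x≢r
  ... | _ , above _ x~y _ = x~y

  depth-parent : ∀ {x} → x ≢ r → depth (parent x) < depth x
  depth-parent {x} x≢r with find-parent x
  ... | _ , root x≡r     = contradiction x≡r x≢r
  ... | _ , above _ _ eq = ≤-reflexive (sym (cong length eq))

  parent-unique : ∀ {x y} → ancestors x ≡ x ∷ ancestors y → x ≢ r → parent x ≡ y
  parent-unique {x} {y} eq x≢r with find-parent x
  ... | _ , root x≡r = contradiction x≡r x≢r
  ... | w , above _ _ eq′ = starts-equal (ancestors-path w)
    (subst (SimplePath r y) (∷-injectiveʳ (trans (sym eq) eq′)) (ancestors-path y))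

  -- If the path from `y` to the root misses `x`, prepending `x` gives the path of `x`. Otherwise
  -- its part from the parent of `y` reaches `x` without meeting `y`, and `no-bypass` identifies `x`
  -- with that parent.
  adj⇒parent : ∀ {x y} → x ~ y → (x ≢ r × parent x ≡ y) ⊎ (y ≢ r × parent y ≡ x)
  adj⇒parent {x} {y} x~y with any? (x ≟ᵥ_) (ancestors y)
  ... | no x∉ = inj₁ (x≢r , parent-unique
          (simple-path-unique acyclic (ancestors-path x) (step x~y (ancestors-path y) x∉)) x≢r)
    where
    x≢r : x ≢ r
    x≢r refl = x∉ (end∈ (ancestors-path y))
  ... | yes x∈ with find-parent y
  ...   | w , above y≢r y~w eq = inj₂ (y≢r , no-bypass acyclic y~w (~-sym x~y) (walk-to (ancestors-path w) y∉ x∈w))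
    where
    x∈w : x ∈ ancestors w
    x∈w with subst (x ∈_) eq x∈
    ... | here refl = contradiction x~y ~-irrefl
    ... | there q   = q
    y∉ : y ∉ ancestors w
    y∉ y∈ with subst Unique eq (unique (ancestors-path y))
    ... | y∉all ∷ _ = All¬⇒¬Any y∉all y∈
  -- The path of the root consists of the root alone, so `x` would be adjacent to itself.
  ...   | _ , root refl = contradiction (subst (_~ y) (x≡r x∈) x~y) ~-irrefl
    where
    x≡r : x ∈ ancestors r → x ≡ r
    x≡r x∈ with simple-path-unique acyclic (ancestors-path r) stop
    ... | eq with subst (x ∈_) eq x∈
    ...   | here x≡r = x≡r

-- Transpositions

module _ {A : Set} (_≟_ : DecidableEquality A) where

  swap : A → A → A → A
  swap a b x with x ≟ a | x ≟ b
  ... | yes _ | _     = b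
  ... | no _  | yes _ = a
  ... | no _  | no _  = x

  swap-left : ∀ a b → swap a b a ≡ b
  swap-left a b with a ≟ a | a ≟ b
  ... | yes _  | _ = refl
  ... | no a≢a | _ = contradiction refl a≢a

  swap-right : ∀ a b → swap a b b ≡ a
  swap-right a b with b ≟ a | b ≟ b
  ... | yes b≡a | _      = b≡a
  ... | no _    | yes _  = refl
  ... | no _    | no b≢b = contradiction refl b≢b

  swap-other : ∀ {a b x} → x ≢ a → x ≢ b → swap a b x ≡ x
  swap-other {a} {b} {x} x≢a x≢b with x ≟ a | x ≟ b
  ... | yes x≡a | _       = contradiction x≡a x≢a
  ... | no _    | yes x≡b = contradiction x≡b x≢b
  ... | no _    | no _    = refl

  swap-involutive : ∀ a b x → swap a b (swap a b x) ≡ x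
  swap-involutive a b x with x ≟ a | x ≟ b
  ... | yes refl | _        = swap-right a b
  ... | no _     | yes refl = swap-left a b
  ... | no x≢a   | no x≢b   = swap-other x≢a x≢b

  swap-injective : ∀ a b → Injective _≡_ _≡_ (swap a b)
  swap-injective a b {x} {y} eq =
    trans (sym (swap-involutive a b x)) (trans (cong (swap a b) eq) (swap-involutive a b y))

-- Trees hanging from a set K

-- top x is the child of root x on the path from root x to x.
record Forest (K X : Set) : Set where
  field
    up       : X → K ⊎ X
    depth    : X → ℕ
    depth-up : ∀ {x y} → up x ≡ inj₂ y → depth y < depth x
    root     : X → K
    root-inj₁ : ∀ {x u} → up x ≡ inj₁ u → root x ≡ u
    root-inj₂ : ∀ {x y} → up x ≡ inj₂ y → root x ≡ root y
    top       : X → X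
    top-inj₁  : ∀ {x u} → up x ≡ inj₁ u → top x ≡ x
    top-inj₂  : ∀ {x y} → up x ≡ inj₂ y → top x ≡ top y

  -- Reflexive on tree vertices and empty for `inj₁ u`: seen from K, every edge `{x , up x}` has `x`
  -- as its farther endpoint.
  data Anc (x : X) : K ⊎ X → Set where
    here  : Anc x (inj₂ x)
    there : ∀ {y} → Anc x (up y) → Anc x (inj₂ y)

  anc-depth : ∀ {x y} → Anc x (inj₂ y) → depth x ≤ depth y
  anc-depth here = ≤-refl
  anc-depth {y = y} (there a) with up y in eq
  ... | inj₂ w = <⇒≤ (≤-<-trans (anc-depth a) (depth-up eq))

  ¬anc-up : ∀ {x} → ¬ Anc x (up x)
  ¬anc-up {x} a with up x in eq
  ... | inj₂ w = <⇒≱ (depth-up eq) (anc-depth a)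

  anc-pred : ∀ {x y} → Anc x (inj₂ y) → x ≢ y → Anc x (up y)
  anc-pred here      x≢y = contradiction refl x≢y
  anc-pred (there a) _   = a

  anc-up : ∀ {x y h} → Anc x h → up x ≡ inj₂ y → Anc y h
  anc-up here      eq = there (subst (Anc _) (sym eq) here)
  anc-up (there a) eq = there (anc-up a eq)

  -- For a proper ancestor `x` of `h`, the child found here is the one whose edge has `x` as its
  -- endpoint farther from `h`.
  anc-child : ∀ {x h} → Anc x h → h ≡ inj₂ x ⊎ ∃ λ y → Anc y h × up y ≡ inj₂ x
  anc-child here = inj₁ refl
  anc-child (there {y} a) with anc-child a
  ... | inj₁ eq           = inj₂ (y , here , eq)
  ... | inj₂ (z , b , eq) = inj₂ (z , there b , eq)

  -- The ancestors of `h` form a chain without siblings: in the mixed cases a vertex would be an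
  -- ancestor of its own parent.
  anc-up-injective : ∀ {x y h} → Anc x h → Anc y h → up x ≡ up y → x ≡ y
  anc-up-injective here      here      eq = refl
  anc-up-injective here      (there b) eq = contradiction (subst (Anc _) eq b) ¬anc-up
  anc-up-injective (there a) here      eq = contradiction (subst (Anc _) (sym eq) a) ¬anc-up
  anc-up-injective (there a) (there b) eq = anc-up-injective a b eq

  anc-root : ∀ {x y} → Anc x (inj₂ y) → root x ≡ root y
  anc-root here = refl
  anc-root {y = y} (there a) with up y in eq
  ... | inj₂ w = trans (anc-root a) (sym (root-inj₂ eq))

  up-induction : ∀ {p} (P : X → Set p) → (∀ x → (∀ {y} → up x ≡ inj₂ y → P y) → P x) → ∀ x → P x
  up-induction P f x = go x (<-wellFounded (depth x))
    where
    go : ∀ x → Acc _<_ (depth x) → P x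
    go x (acc rec) = f x (λ {y} eq → go y (rec (depth-up eq)))

  anc-top : ∀ x → Anc (top x) (inj₂ x) × up (top x) ≡ inj₁ (root x)
  anc-top = up-induction _ step
    where
    step : ∀ x → (∀ {y} → up x ≡ inj₂ y → Anc (top y) (inj₂ y) × up (top y) ≡ inj₁ (root y)) →
           Anc (top x) (inj₂ x) × up (top x) ≡ inj₁ (root x)
    step x ih with up x in eq
    ... | inj₁ u rewrite top-inj₁ eq | root-inj₁ eq = here , eq
    ... | inj₂ y rewrite top-inj₂ eq | root-inj₂ eq =
      there (subst (Anc _) (sym eq) (proj₁ (ih refl))) , proj₂ (ih refl)

  module _ (_≟ˣ_ : DecidableEquality X) where

    anc? : ∀ x h → Dec (Anc x h)
    anc? x (inj₁ u) = no λ ()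
    anc? x (inj₂ y) = up-induction (λ y → Dec (Anc x (inj₂ y))) step y
      where
      step : ∀ y → (∀ {w} → up y ≡ inj₂ w → Dec (Anc x (inj₂ w))) → Dec (Anc x (inj₂ y))
      step y ih with x ≟ˣ y
      ... | yes refl = yes here
      ... | no x≢y with up y in eq
      ...   | inj₁ u = no λ a → lemma (subst (Anc x) eq (anc-pred a x≢y))
        where
        lemma : ¬ Anc x (inj₁ u)
        lemma ()
      ...   | inj₂ w = map′ (λ a → there (subst (Anc x) (sym eq) a))
                            (λ a → subst (Anc x) eq (anc-pred a x≢y)) (ih refl)

-- tag q is the tree vertex x whose edge {x , up x} owns the slot q, or nothing if
-- q is a hole.
-- The walk on pairs of a held vertex and a pointer

module Model {l : ℕ} {K X : Set} (_≟_ : DecidableEquality (K ⊎ X)) (F : Forest K X)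
  (tag : Fin (suc l) → Maybe X) (slot : X → Fin (suc l))
  (tag-slot : ∀ x → tag (slot x) ≡ just x) (slot-tag : ∀ {q x} → tag q ≡ just x → slot x ≡ q)
  where

  open Forest F

  private
    V = K ⊎ X
    M = suc l

  _≟ˣ_ : DecidableEquality X
  x ≟ˣ y = map′ inj₂-injective (cong inj₂) (inj₂ x ≟ inj₂ y)

  hole : Maybe X → ℕ
  hole (just _) = 0
  hole nothing  = 1

  holes : Fin M → ℕ → ℕ
  holes p zero    = 0
  holes p (suc k) = hole (tag p) + holes (next p) k

  holes-suc : ∀ p k → holes p (suc k) ≡ holes p k + hole (tag (iterate next p k))
  holes-suc p zero    = +-identityʳ _
  holes-suc p (suc k) = trans (cong (hole (tag p) +_) (holes-suc (next p) k)) (sym (+-assoc (hole (tag p)) _ _))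

  -- Advancing the start by one slot moves that slot from the front of the turn to its end.
  holes-turn : ∀ p q → holes p M ≡ holes q M
  holes-turn p q = subst (λ w → holes p M ≡ holes w M) (next^dist p q) (go p (dist p q))
    where
    open ≡-Reasoning
    step : ∀ p → holes p M ≡ holes (next p) M
    step p = begin
      hole (tag p) + holes (next p) l                             ≡⟨ +-comm (hole (tag p)) _ ⟩
      holes (next p) l + hole (tag p)                             ≡⟨ cong (λ w → holes (next p) l + hole (tag w)) (next^N p) ⟨
      holes (next p) l + hole (tag (iterate next (next p) l))     ≡⟨ holes-suc (next p) l ⟨
      holes (next p) M                                            ∎
    go : ∀ p k → holes p M ≡ holes (iterate next p k) M
    go p zero    = refl
    go p (suc k) = trans (step p) (go (next p) k)

  rootOf : V → K
  rootOf (inj₁ u) = u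
  rootOf (inj₂ x) = root x

  -- The contents of the holes are frozen while the walk is inside a tree, so
  -- they are read off where the walk left K.
  base : V → Fin M → Fin M
  base (inj₁ u) p = p
  base (inj₂ x) p = slot (top x)

  tag-view : ∀ q → (∃ λ x → tag q ≡ just x) ⊎ tag q ≡ nothing
  tag-view q with tag q
  ... | just x  = inj₁ (x , refl)
  ... | nothing = inj₂ refl

  hole≢slot : ∀ {q x} → tag q ≡ nothing → slot x ≢ q
  hole≢slot {x = x} eq refl with () ← trans (sym eq) (tag-slot x)

  nth-hole : ∀ p m j → j < holes p m →
    ∃ λ k → k < m × tag (iterate next p k) ≡ nothing × holes p k ≡ j
  nth-hole p (suc m) j j< with tag p in eq
  nth-hole p (suc m) j j< | just x with nth-hole (next p) m j j<
  ... | k , k<m , is-hole , refl =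
    suc k , s≤s k<m , is-hole , cong (λ t → hole t + holes (next p) k) eq
  nth-hole p (suc m) zero    j< | nothing = 0 , s≤s z≤n , eq , refl
  nth-hole p (suc m) (suc j) j< | nothing with nth-hole (next p) m j (≤-pred j<)
  ... | k , k<m , is-hole , refl =
    suc k , s≤s k<m , is-hole , cong (λ t → hole t + holes (next p) k) eq

  holes-< : ∀ p {k m} → k < m → tag (iterate next p k) ≡ nothing → holes p k < holes p m
  holes-< p {zero}  {suc m} k<m eq rewrite eq = s≤s z≤n
  holes-< p {suc k} {suc m} k<m eq = +-monoʳ-< (hole (tag p)) (holes-< (next p) (≤-pred k<m) eq)

  rank : Fin M → Fin M → ℕ
  rank b q = holes b (dist b q)

  rank-< : ∀ b {q k} → tag q ≡ nothing → dist b q < k → rank b q < holes b k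
  rank-< b {q} eq d< = holes-< b d< (trans (cong tag (next^dist b q)) eq)

  -- Ranks of holes strictly increase with the distance from `b`, since the nearer hole is counted
  -- in the rank of the farther one.
  rank-injective : ∀ b {q q′} → tag q ≡ nothing → tag q′ ≡ nothing → rank b q ≡ rank b q′ → q ≡ q′
  rank-injective b {q} {q′} eq eq′ same with <-cmp (dist b q) (dist b q′)
  ... | tri< lt _ _ = contradiction same (<⇒≢ (rank-< b eq lt))
  ... | tri> _ _ gt = contradiction (sym same) (<⇒≢ (rank-< b eq′ gt))
  ... | tri≈ _ d≡ _ = trans (sym (next^dist b q)) (trans (cong (iterate next b) d≡) (next^dist b q′))

  rank-surjective : ∀ b j → j < holes b M → ∃ λ q → tag q ≡ nothing × rank b q ≡ j
  rank-surjective b j j< with nth-hole b M j j<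
  ... | k , k<M , is-hole , eq = iterate next b k , is-hole , trans (cong (holes b) (dist-next^ b k<M)) eq

  -- Slot contents and the walk for a given cyclic order `κ`

  module Dynamics (κ : K → K) (κ-order : ∀ u p → iterate κ u (suc (holes p M)) ≡ u) where

    -- The content of the hole q when the pointer is at p and u ∈ K is held.
    holeContent : K → Fin M → Fin M → K
    holeContent u p q = iterate κ (κ u) (holes p (dist p q))

    -- The slot of a tree edge contains its endpoint that is farther from h.
    farEnd : ∀ {x h} → Dec (Anc x h) → V
    farEnd {x} (yes _) = up x
    farEnd {x} (no _)  = inj₂ x

    slotContent : V → Fin M → Fin M → Maybe X → V
    slotContent h b q (just x) = farEnd (anc? _≟ˣ_ x h)
    slotContent h b q nothing  = inj₁ (holeContent (rootOf h) b q)

    content : V → Fin M → Fin M → V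
    content h p q = slotContent h (base h p) q (tag q)

    move : Maybe X → V → V
    move (just x) h        = swap _≟_ (inj₂ x) (up x) h
    move nothing  (inj₁ u) = inj₁ (κ u)
    move nothing  (inj₂ x) = inj₂ x

    walk : V × Fin M → V × Fin M
    walk (h , p) = move (tag p) h , next p

    -- By `κ-order`, `holes p M` further iterations undo `κ`; `p` fixes where the counting of holes
    -- starts.
    κ-injective : Fin M → Injective _≡_ _≡_ κ
    κ-injective p {u} {w} eq = trans (sym (κ-order u p))
      (trans (cong (λ v → iterate κ v (holes p M)) eq) (κ-order w p))

    move-injective : Fin M → ∀ t → Injective _≡_ _≡_ (move t)
    move-injective p (just x) eq = swap-injective _≟_ (inj₂ x) (up x) eq
    move-injective p nothing {inj₁ u} {inj₁ w} eq = cong inj₁ (κ-injective p (inj₁-injective eq))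
    move-injective p nothing {inj₂ x} {inj₂ y} eq = eq

    walk-injective : Injective _≡_ _≡_ walk
    walk-injective {h , p} {h′ , p′} eq with next-injective (cong proj₂ eq)
    ... | refl = cong (_, p) (move-injective p (tag p) (cong proj₁ eq))

    content-anc : ∀ {h p q x} → tag q ≡ just x → Anc x h → content h p q ≡ up x
    content-anc {h} {x = x} eq a rewrite eq with anc? _≟ˣ_ x h
    ... | yes _ = refl
    ... | no ¬a = contradiction a ¬a

    content-¬anc : ∀ {h p q x} → tag q ≡ just x → ¬ Anc x h → content h p q ≡ inj₂ x
    content-¬anc {h} {x = x} eq ¬a rewrite eq with anc? _≟ˣ_ x h
    ... | yes a = contradiction a ¬a
    ... | no _  = refl

    content-hole : ∀ {h p q} → tag q ≡ nothing → content h p q ≡ inj₁ (holeContent (rootOf h) (base h p) q)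
    content-hole eq rewrite eq = refl

    content-unique : ∀ {h p} (w : Fin M → V) → (∀ {x} → Anc x h → w (slot x) ≡ up x) →
      (∀ {x} → ¬ Anc x h → w (slot x) ≡ inj₂ x) →
      (∀ {q} → tag q ≡ nothing → w q ≡ inj₁ (holeContent (rootOf h) (base h p) q)) →
      ∀ q → w q ≡ content h p q
    content-unique {h} {p} w w-anc w-¬anc w-hole q with tag-view q
    ... | inj₂ is-hole = trans (w-hole is-hole) (sym (content-hole {h} {p} is-hole))
    ... | inj₁ (x , is-edge) with anc? _≟ˣ_ x h
    ...   | yes a = trans (cong w (sym (slot-tag is-edge))) (trans (w-anc a) (sym (content-anc {p = p} is-edge a)))
    ...   | no ¬a = trans (cong w (sym (slot-tag is-edge))) (trans (w-¬anc ¬a) (sym (content-¬anc {p = p} is-edge ¬a)))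

    content-anc-cong : ∀ {h h′ p p′ q x} → tag q ≡ just x → (Anc x h → Anc x h′) → (Anc x h′ → Anc x h) →
                       content h p q ≡ content h′ p′ q
    content-anc-cong {h} {x = x} eq to from with anc? _≟ˣ_ x h
    ... | yes a = trans (content-anc eq a) (sym (content-anc eq (to a)))
    ... | no ¬a = trans (content-¬anc eq ¬a) (sym (content-¬anc eq (¬a ∘ from)))

    content-hole-cong : ∀ {h h′ p p′ q} → tag q ≡ nothing →
      holeContent (rootOf h) (base h p) q ≡ holeContent (rootOf h′) (base h′ p′) q →
      content h p q ≡ content h′ p′ q
    content-hole-cong eq eq′ =
      trans (content-hole eq) (trans (cong inj₁ eq′) (sym (content-hole eq)))

    holeContent-self : ∀ u p → holeContent u p p ≡ κ u
    holeContent-self u p rewrite dist-self p = refl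

    holeContent-edge : ∀ {u p q x} → tag p ≡ just x → p ≢ q → holeContent u p q ≡ holeContent u (next p) q
    holeContent-edge eq p≢q rewrite dist-suc p≢q | eq = refl

    -- The hole passed no longer counts in the exponent, and the held vertex gains one application
    -- of `κ` instead.
    holeContent-hole : ∀ {u p q} → tag p ≡ nothing → p ≢ q → holeContent u p q ≡ holeContent (κ u) (next p) q
    holeContent-hole eq p≢q rewrite dist-suc p≢q | eq = refl

    -- Slot `p` now comes last in the turn, so all other holes count and the total exponent is
    -- `suc (holes p M)`, to which `κ-order` applies.
    holeContent-pred : ∀ {u p} → tag p ≡ nothing → holeContent (κ u) (next p) p ≡ u
    holeContent-pred {u} {p} eq = begin
      iterate κ (κ (κ u)) (holes (next p) (dist (next p) p)) ≡⟨ cong (λ k → iterate κ (κ (κ u)) (holes (next p) k)) (dist-pred p) ⟩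
      iterate κ (κ (κ u)) (holes (next p) l)                 ≡⟨ cong (λ t → iterate κ (κ u) (hole t + holes (next p) l)) eq ⟨
      iterate κ u (suc (holes p M))                          ≡⟨ κ-order u p ⟩
      u                                                      ∎
      where open ≡-Reasoning

    -- One step of the queue

    module Adjacency (_~_ : V → V → Set) (~-sym : ∀ {h h′} → h ~ h′ → h′ ~ h)
      (up-adj : ∀ x → up x ~ inj₂ x)
      (adj-tree : ∀ {h x} → h ~ inj₂ x → h ≡ up x ⊎ ∃ λ y → h ≡ inj₂ y × up y ≡ inj₂ x)
      (clique : ∀ {u w} → u ≢ w → inj₁ u ~ inj₁ w)
      where

      -- The constructors mirror the branches of `TPro`: adjacent vertices trade places and the old
      -- held vertex stays behind in slot `p`; otherwise the queue is unchanged.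
      data Step (h : V) (p : Fin M) : Set where
        exchange : ∀ {h′} → move (tag p) h ≡ h′ → h ~ h′ → content h p p ≡ h′ → content h′ (next p) p ≡ h →
          (∀ q → p ≢ q → content h′ (next p) q ≡ content h p q) → Step h p
        pass : move (tag p) h ≡ h → ¬ (h ~ content h p p) →
          (∀ q → content h (next p) q ≡ content h p q) → Step h p

      move-edge : ∀ {p x h} → tag p ≡ just x → move (tag p) h ≡ swap _≟_ (inj₂ x) (up x) h
      move-edge {h = h} eq = cong (λ t → move t h) eq

      ≢-edge : ∀ {p q x y} → tag p ≡ just x → p ≢ q → tag q ≡ just y → x ≢ y
      ≢-edge eq p≢q eq′ refl = p≢q (trans (sym (slot-tag eq)) (slot-tag eq′))

      edge≢hole : ∀ {p q x} → tag p ≡ just x → tag q ≡ nothing → p ≢ q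
      edge≢hole eq eq′ refl with () ← trans (sym eq) eq′

      content-next : ∀ {h p q x} → tag p ≡ just x → content h p q ≡ content h (next p) q
      content-next {h} {p} {q} eq with tag-view q
      ... | inj₁ (_ , eq′) = content-anc-cong {p = p} {p′ = next p} eq′ (λ a → a) (λ a → a)
      ... | inj₂ eq′ with h
      ...   | inj₁ u = content-hole-cong {inj₁ u} {inj₁ u} eq′ (holeContent-edge eq (edge≢hole eq eq′))
      -- Inside a tree `base` ignores the pointer, so both contents agree by definition.
      ...   | inj₂ y = refl

      -- Between `x` and `up x` only the edge of `x` changes its farther endpoint. If `up x` lies in
      -- K, the base moves from `slot x`, which is `p`, to `next p` without passing a hole.
      content-up : ∀ {x p q} → tag p ≡ just x → p ≢ q → content (inj₂ x) p q ≡ content (up x) (next p) q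
      content-up {x} {p} {q} eq p≢q with tag-view q
      ... | inj₁ (y , eq′) = content-anc-cong {p = p} {p′ = next p} eq′
              (λ a → anc-pred a (≢-edge eq p≢q eq′ ∘ sym)) there
      ... | inj₂ eq′ = content-hole-cong {inj₂ x} {up x} {p} {next p} eq′ same
        where
        same : holeContent (root x) (slot (top x)) q ≡ holeContent (rootOf (up x)) (base (up x) (next p)) q
        same with up x in eq″
        ... | inj₁ u rewrite root-inj₁ eq″ | top-inj₁ eq″ | slot-tag eq = holeContent-edge eq p≢q
        ... | inj₂ y rewrite root-inj₂ eq″ | top-inj₂ eq″ = refl

      -- A child of `up x` below `x` can only be `x`, by `anc-up-injective`, and the parent of
      -- `up x` is too shallow to lie below `x`.
      ¬adj-up : ∀ {x h} → Anc x h → h ≢ inj₂ x → ¬ (h ~ up x)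
      ¬adj-up {x} {inj₂ y} a h≢x h~up with adj-tree (~-sym h~up)
      ... | inj₁ eq = h≢x (cong inj₂ (sym (anc-up-injective a here eq)))
      ... | inj₂ (z , eq , eq′) =
        <⇒≱ (<-trans (depth-up eq′) (depth-up eq)) (anc-depth a)

      ¬adj-below : ∀ {x h} → ¬ Anc x h → h ≢ up x → ¬ (h ~ inj₂ x)
      ¬adj-below ¬a h≢up h~x with adj-tree h~x
      ... | inj₁ eq              = h≢up eq
      ... | inj₂ (y , refl , eq) = ¬a (there (subst (Anc _) (sym eq) here))

      -- The two hypotheses will come from the bijectivity of the labeling: the content of slot `p`
      -- is not held and occurs in no other slot.
      step : ∀ h p → content h p p ≢ h → (∀ q → content h p p ≡ content h p q → p ≡ q) → Step h p
      step h p c≢h inj with tag-view p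
      step h p c≢h inj | inj₁ (x , eq) with h ≟ inj₂ x | h ≟ up x
      ... | yes refl | _ = exchange (trans (move-edge eq) (swap-left _≟_ _ _)) (~-sym (up-adj x))
              (content-anc {p = p} eq here) (content-¬anc {up x} {next p} eq ¬anc-up)
              (λ q p≢q → sym (content-up eq p≢q))
      ... | no _ | yes refl = exchange (trans (move-edge eq) (swap-right _≟_ _ _)) (up-adj x)
              (content-¬anc {p = p} eq ¬anc-up) (content-anc {inj₂ x} {next p} eq here)
              (λ q p≢q → trans (sym (content-next {inj₂ x} eq))
                (trans (content-up eq p≢q) (sym (content-next {up x} eq))))
      ... | no h≢x | no h≢up = pass (trans (move-edge eq) (swap-other _≟_ h≢x h≢up)) ¬adj
              (λ q → sym (content-next {h} eq))
        where
        ¬adj : ¬ (h ~ content h p p)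
        ¬adj with anc? _≟ˣ_ x h
        ... | yes a = ¬adj-up a h≢x ∘ subst (h ~_) (content-anc {p = p} eq a)
        ... | no ¬a = ¬adj-below ¬a h≢up ∘ subst (h ~_) (content-¬anc {p = p} eq ¬a)
      step (inj₁ u) p c≢h inj | inj₂ eq =
        -- The hole contains `κ u`, which is therefore not the held `u`, and the clique makes them
        -- adjacent.
        exchange (cong (λ t → move t (inj₁ u)) eq) (clique (λ u≡κu → c≢h (trans c≡κu (cong inj₁ (sym u≡κu)))))
          c≡κu (trans (content-hole {inj₁ (κ u)} {next p} eq) (cong inj₁ (holeContent-pred eq))) same
        where
        c≡κu : content (inj₁ u) p p ≡ inj₁ (κ u)
        c≡κu = trans (content-hole {inj₁ u} {p} eq) (cong inj₁ (holeContent-self u p))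
        same : ∀ q → p ≢ q → content (inj₁ (κ u)) (next p) q ≡ content (inj₁ u) p q
        same q p≢q with tag-view q
        ... | inj₁ (_ , eq′) = content-anc-cong {p = next p} {p′ = p} eq′ (λ ()) (λ ())
        ... | inj₂ eq′ = content-hole-cong {inj₁ (κ u)} {inj₁ u} eq′ (sym (holeContent-hole eq p≢q))
      step (inj₂ y) p c≢h inj | inj₂ eq = pass (cong (λ t → move t (inj₂ y)) eq) ¬adj (λ q → refl)
        where
        ¬adj : ¬ (inj₂ y ~ content (inj₂ y) p p)
        ¬adj adj with adj-tree (~-sym (subst (inj₂ y ~_) (content-hole {inj₂ y} {p} eq) adj))
        -- A neighbour of `y` in K must be `up y`, but that vertex already sits in `slot y`, which
        -- is not a hole.
        ... | inj₁ k≡up = edge≢hole (tag-slot y) eq (sym (inj (slot y) (trans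
                (content-hole {inj₂ y} {p} eq) (trans k≡up (sym (content-anc {p = p} (tag-slot y) here))))))

    -- All pairs lie on one cycle

    module Connectivity (B : ℕ) (depth≤B : ∀ x → depth x ≤ B)
      (κ-transitive : ∀ u w → ∃ λ k → iterate κ u k ≡ w) where

      infix 4 _↭_
      _↭_ : V × Fin M → V × Fin M → Set
      _↭_ = SameOrbit walk

      walk-edge : ∀ {h h′ q x} → tag q ≡ just x → swap _≟_ (inj₂ x) (up x) h ≡ h′ → (h , q) ↭ (h′ , next q)
      walk-edge {h} {q = q} eq eq′ = same-step walk (cong (_, next q) (trans (cong (λ t → move t h) eq) eq′))

      walk-hole : ∀ {h q} → tag q ≡ nothing → (h , q) ↭ (move nothing h , next q)
      walk-hole {h} {q} eq = same-step walk (cong (λ t → move t h , next q) eq)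

      -- Descending at `slot x` leads to the left-hand pair, and staying at `up x` would lead to the
      -- right-hand one; so excursions can be ignored up to `↭`.
      Returns : X → Set
      Returns x = (inj₂ x , next (slot x)) ↭ (up x , next (slot x))

      around : ∀ {h p} → (∀ q → p ≢ q → (h , q) ↭ (h , next q)) → (h , next p) ↭ (h , p)
      around {h} {p} stay = subst (λ q → (h , next p) ↭ (h , q)) (next^N p) (go l ≤-refl)
        where
        go : ∀ k → k ≤ l → (h , next p) ↭ (h , iterate next (next p) k)
        go zero    _   = same-refl walk
        go (suc k) k<l = same-trans walk (go k (<⇒≤ k<l))
          (subst (λ q → (h , q′) ↭ (h , q)) (sym (iterate-suc next (next p) k)) (stay q′ p≢q′))
          where
          q′ = iterate next (next p) k
          p≢q′ : p ≢ q′
          p≢q′ p≡q′ = <⇒≢ k<l (next^-injective (next p) (m<n⇒m<1+n k<l) ≤-refl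
            (trans (sym p≡q′) (sym (next^N p))))

      stay-inside : ∀ {x} → (∀ y → up y ≡ inj₂ x → Returns y) →
        ∀ q → slot x ≢ q → (inj₂ x , q) ↭ (inj₂ x , next q)
      stay-inside {x} returns q slot≢q with tag q in eq
      ... | nothing = walk-hole eq
      ... | just y with inj₂ x ≟ up y
      ...   | no x≢up = walk-edge eq (swap-other _≟_ (λ { refl → slot≢q (slot-tag eq) }) x≢up)
      ...   | yes x≡up = same-trans walk
              (walk-edge eq (trans (cong (swap _≟_ _ _) x≡up) (swap-right _≟_ _ _)))
              (subst₂ (λ h p → (inj₂ y , next p) ↭ (h , next p)) (sym x≡up) (slot-tag eq) (returns y (sym x≡up)))

      -- Once the subtrees below x are known to be left through the slot by which
      -- they were entered, the walk at x passes all slots in turn until it meets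
      -- up x in the slot of x.
      all-return : ∀ x → Returns x
      all-return x = go (suc B) x (m≤n+m (suc B) (depth x))
        where
        -- Induction on `k`, which bounds the height left below `x`: children are deeper, and no
        -- depth exceeds `B`.
        go : ∀ k x → B < depth x + k → Returns x
        go zero    x B<d = contradiction (depth≤B x) (<⇒≱ (subst (B <_) (+-identityʳ _) B<d))
        go (suc k) x B<d = same-trans walk (around (stay-inside children))
          (walk-edge (tag-slot x) (swap-left _≟_ _ _))
          where
          children : ∀ y → up y ≡ inj₂ x → Returns y
          children y eq = go k y (<-≤-trans B<d
            (subst (_≤ depth y + k) (sym (+-suc (depth x) k)) (+-monoˡ-≤ k (depth-up eq))))

      stay-tree : ∀ x q → (inj₂ x , q) ↭ (inj₂ x , next q)
      stay-tree x q with slot x Fin.≟ q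
      ... | no slot≢q = stay-inside (λ y _ → all-return y) q slot≢q
      -- At its own slot `x` moves to `up x`; the return relation read backwards leads to `x` again.
      ... | yes refl  = same-trans walk (walk-edge (tag-slot x) (swap-left _≟_ _ _)) (same-sym walk (all-return x))

      stay-edge : ∀ {u q x} → tag q ≡ just x → (inj₁ u , q) ↭ (inj₁ u , next q)
      stay-edge {u} {q} {x} eq with inj₁ u ≟ up x
      ... | no u≢up = walk-edge eq (swap-other _≟_ (λ ()) u≢up)
      ... | yes u≡up = same-trans walk
        (walk-edge eq (trans (cong (swap _≟_ _ _) u≡up) (swap-right _≟_ _ _)))
        (subst₂ (λ h p → (inj₂ x , next p) ↭ (h , next p)) (sym u≡up) (slot-tag eq) (all-return x))

      -- Up to `↭` edge slots leave `u` in place, and each hole applies `κ` once.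
      turn : ∀ u p k → (inj₁ u , p) ↭ (inj₁ (iterate κ u (holes p k)) , iterate next p k)
      turn u p zero    = same-refl walk
      turn u p (suc k) with tag p in eq
      ... | just x  = same-trans walk (stay-edge eq) (turn u (next p) k)
      ... | nothing = same-trans walk (walk-hole eq) (turn (κ u) (next p) k)

      -- A whole turn inside K acts as κ⁻¹.
      rotate : ∀ u p → (inj₁ u , p) ↭ (inj₁ (κ u) , p)
      rotate u p = same-sym walk (subst₂ (λ w q → (inj₁ (κ u) , p) ↭ (inj₁ w , q)) (κ-order u p) (next^N p) (turn (κ u) p M))

      within-K : ∀ u w p → (inj₁ u , p) ↭ (inj₁ w , p)
      within-K u w p with κ-transitive u w
      ... | k , eq = subst (λ w → (inj₁ u , p) ↭ (inj₁ w , p)) eq (go u k)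
        where
        go : ∀ u k → (inj₁ u , p) ↭ (inj₁ (iterate κ u k) , p)
        go u zero    = same-refl walk
        go u (suc k) = same-trans walk (rotate u p) (go (κ u) k)

      stay : ∀ h q → (h , q) ↭ (h , next q)
      stay (inj₂ x) q = stay-tree x q
      stay (inj₁ u) q with tag q in eq
      ... | just x  = stay-edge eq
      ... | nothing = same-trans walk (walk-hole eq) (within-K (κ u) u (next q))

      any-slot : ∀ h p q → (h , p) ↭ (h , q)
      any-slot h p q = subst (λ q → (h , p) ↭ (h , q)) (next^dist p q) (go p (dist p q))
        where
        go : ∀ p k → (h , p) ↭ (h , iterate next p k)
        go p zero    = same-refl walk
        go p (suc k) = same-trans walk (stay h p) (go (next p) k)

      -- The pointer is turned to `next (slot x)`, where `all-return` links `x` with `up x`, and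
      -- then turned back.
      to-root : ∀ x p → (inj₂ x , p) ↭ (inj₁ (root x) , p)
      to-root = up-induction _ λ x ih p → same-trans walk (any-slot (inj₂ x) p (next (slot x)))
        (same-trans walk (all-return x) (same-trans walk (any-slot (up x) (next (slot x)) p) (climb x ih p)))
        where
        climb : ∀ x → (∀ {y} → up x ≡ inj₂ y → ∀ p → (inj₂ y , p) ↭ (inj₁ (root y) , p)) →
          ∀ p → (up x , p) ↭ (inj₁ (root x) , p)
        climb x ih p with up x in eq
        ... | inj₁ u rewrite root-inj₁ eq = same-refl walk
        ... | inj₂ y rewrite root-inj₂ eq = ih refl p

      to-rootOf : ∀ h p → (h , p) ↭ (inj₁ (rootOf h) , p)
      to-rootOf (inj₁ u) p = same-refl walk
      to-rootOf (inj₂ x) p = to-root x p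

      single-orbit : ∀ a b → a ↭ b
      single-orbit (h , p) (h′ , p′) = same-trans walk (any-slot h p p′) (same-trans walk (to-rootOf h p′)
        (same-trans walk (within-K _ _ p′) (same-sym walk (to-rootOf h′ p′))))

-- The cyclic order of K in a given state

module Cycle {A : Set} {n : ℕ} (e : Fin (suc n) ↔ A) where

  open Inverse e

  successor : A → A
  successor a = to (next (from a))

  successor^ : ∀ j k → iterate successor (to j) k ≡ to (iterate next j k)
  successor^ j zero    = refl
  successor^ j (suc k) =
    trans (cong (λ i → iterate successor (to (next i)) k) (strictlyInverseʳ j)) (successor^ (next j) k)

  successor-order : ∀ a → iterate successor a (suc n) ≡ a
  successor-order a = begin
    iterate successor a (suc n)             ≡⟨ cong (λ a → iterate successor a (suc n)) (strictlyInverseˡ a) ⟨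
    iterate successor (to (from a)) (suc n) ≡⟨ successor^ (from a) (suc n) ⟩
    to (iterate next (from a) (suc n))      ≡⟨ cong to (next^N (from a)) ⟩
    to (from a)                             ≡⟨ strictlyInverseˡ a ⟩
    a                                       ∎
    where open ≡-Reasoning

  successor-transitive : ∀ a b → ∃ λ k → iterate successor a k ≡ b
  successor-transitive a b = k , (begin
    iterate successor a k             ≡⟨ cong (λ a → iterate successor a k) (strictlyInverseˡ a) ⟨
    iterate successor (to (from a)) k ≡⟨ successor^ (from a) k ⟩
    to (iterate next (from a) k)      ≡⟨ cong to (next^dist (from a) (from b)) ⟩
    to (from b)                       ≡⟨ strictlyInverseˡ b ⟩
    b                                 ∎)
    where
    open ≡-Reasoning
    k = dist (from a) (from b)

  successor^-zero : ∀ (i : Fin (suc n)) → iterate successor (to zero) (toℕ i) ≡ to i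
  successor^-zero i = trans (successor^ zero (toℕ i)) (cong to (toℕ-injective
    (trans (toℕ-next^ zero (toℕ i)) (m<n⇒m%n≡m (toℕ<n i)))))

-- Assigning slots to the tree edges in an initial state

module Placement {l N : ℕ} {K X : Set} (finite : (K ⊎ X) ↔ Fin N) (_≟_ : DecidableEquality (K ⊎ X))
  (F : Forest K X)
  (h₀ : K ⊎ X) (p₀ : Fin (suc l)) (w : Fin (suc l) → K ⊎ X) (w-injective : Injective _≡_ _≡_ w)
  (w≢h₀ : ∀ q → w q ≢ h₀) (find : ∀ v → v ≢ h₀ → ∃ λ q → w q ≡ v)
  where

  open Forest F

  private
    V = K ⊎ X
    M = suc l

  search : ∀ {P : X → Set} → (∀ x → Dec (P x)) → Dec (∃ P)
  search {P} P? = map′ (λ (_ , x , _ , px) → x , px)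
    (λ (x , px) → Inverse.to finite (inj₂ x) , x , Inverse.strictlyInverseʳ finite _ , px)
    (Fin.any? λ j → at (Inverse.from finite j))
    where
    at : ∀ v → Dec (∃ λ x → v ≡ inj₂ x × P x)
    at (inj₁ u) = no λ ()
    at (inj₂ x) = map′ (λ px → x , refl , px) (λ { (_ , refl , px) → px }) (P? x)

  private
    _≟ˣ_ : DecidableEquality X
    x ≟ˣ y = map′ inj₂-injective (cong inj₂) (inj₂ x ≟ inj₂ y)

    -- The endpoint farther from `h₀` is never `h₀` itself, so `find` locates it in the queue.
    placement : ∀ x → ∃ λ q → (Anc x h₀ × w q ≡ up x) ⊎ (¬ Anc x h₀ × w q ≡ inj₂ x)
    placement x with anc? _≟ˣ_ x h₀
    ... | yes a with find (up x) (λ { refl → ¬anc-up a })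
    ...   | q , eq = q , inj₁ (a , eq)
    placement x | no ¬a with find (inj₂ x) (λ { refl → ¬a here })
    ...   | q , eq = q , inj₂ (¬a , eq)

  slot : X → Fin M
  slot x = proj₁ (placement x)

  slot-spec : ∀ x → (Anc x h₀ × w (slot x) ≡ up x) ⊎ (¬ Anc x h₀ × w (slot x) ≡ inj₂ x)
  slot-spec x = proj₂ (placement x)

  w-slot-anc : ∀ {x} → Anc x h₀ → w (slot x) ≡ up x
  w-slot-anc {x} a with slot-spec x
  ... | inj₁ (_ , eq)  = eq
  ... | inj₂ (¬a , _)  = contradiction a ¬a

  w-slot-¬anc : ∀ {x} → ¬ Anc x h₀ → w (slot x) ≡ inj₂ x
  w-slot-¬anc {x} ¬a with slot-spec x
  ... | inj₁ (a , _)  = contradiction a ¬a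
  ... | inj₂ (_ , eq) = eq

  -- Equal slots would give two edges the same farther endpoint. In a mixed case, the child of an
  -- ancestor edge would turn its parent, the other vertex, into an ancestor of `h₀`.
  slot-injective : Injective _≡_ _≡_ slot
  slot-injective {x} {y} eq with slot-spec x | slot-spec y
  ... | inj₁ (a , p)  | inj₁ (b , q)  = anc-up-injective a b (trans (sym p) (trans (cong w eq) q))
  ... | inj₁ (a , p)  | inj₂ (¬b , q) = contradiction (anc-up a (trans (sym p) (trans (cong w eq) q))) ¬b
  ... | inj₂ (¬a , p) | inj₁ (b , q)  = contradiction (anc-up b (trans (sym q) (trans (cong w (sym eq)) p))) ¬a
  ... | inj₂ (_ , p)  | inj₂ (_ , q)  = inj₂-injective (trans (sym p) (trans (cong w eq) q))

  tag : Fin M → Maybe X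
  tag q with search (λ x → slot x Fin.≟ q)
  ... | yes (x , _) = just x
  ... | no _        = nothing

  slot-tag : ∀ {q x} → tag q ≡ just x → slot x ≡ q
  slot-tag {q} eq with search (λ x → slot x Fin.≟ q)
  ... | yes (x , slot≡q) = trans (cong slot (sym (just-injective eq))) slot≡q

  tag-slot : ∀ x → tag (slot x) ≡ just x
  tag-slot x with search (λ y → slot y Fin.≟ slot x)
  ... | yes (y , eq) = cong just (slot-injective eq)
  ... | no ∄         = contradiction (x , refl) ∄

  open Model _≟_ F tag slot tag-slot slot-tag hiding (_≟ˣ_)

  -- Every other vertex is accounted for: a tree vertex is held, or is the farther endpoint of its
  -- own edge or of the edge from a child; a root not held sits in the slot of the top edge above
  -- `h₀`.
  occupant : ∀ {q} → tag q ≡ nothing → ∃ λ u → w q ≡ inj₁ u × u ≢ rootOf h₀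
  occupant {q} is-hole with w q in eq
  ... | inj₁ u = u , refl , ≢root h₀ refl
    where
    ≢root : ∀ h → h ≡ h₀ → u ≢ rootOf h
    ≢root (inj₁ u) refl refl = w≢h₀ q eq
    ≢root (inj₂ x) refl refl = hole≢slot is-hole (w-injective
      (trans (w-slot-anc (proj₁ (anc-top x))) (trans (proj₂ (anc-top x)) (sym eq))))
  ... | inj₂ y with anc? _≟ˣ_ y h₀
  ...   | no ¬a = contradiction (w-injective (trans (w-slot-¬anc ¬a) (sym eq))) (hole≢slot is-hole)
  ...   | yes a with anc-child a
  ...     | inj₁ h₀≡y = contradiction (trans eq (sym h₀≡y)) (w≢h₀ q)
  ...     | inj₂ (z , c , up≡) = contradiction
    (w-injective (trans (w-slot-anc c) (trans up≡ (sym eq)))) (hole≢slot is-hole)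

  -- A vertex of K in an edge slot is `up x` for an ancestor `x` of `h₀`, hence the root of the tree
  -- of `h₀`.
  occupied : ∀ u → u ≢ rootOf h₀ → ∃ λ q → tag q ≡ nothing × w q ≡ inj₁ u
  occupied u u≢root with find (inj₁ u) (λ eq → u≢root (cong rootOf eq))
  ... | q , eq with tag-view q
  ...   | inj₂ is-hole = q , is-hole , eq
  ...   | inj₁ (x , is-edge) with slot-spec x
  ...     | inj₂ (_ , eq′) with () ← trans (sym eq) (trans (cong w (sym (slot-tag is-edge))) eq′)
  ...     | inj₁ (a , eq′) = contradiction (go h₀ a) u≢root
    where
    go : ∀ h → Anc x h → u ≡ rootOf h
    go (inj₂ y) a = trans (sym (root-inj₁
      (trans (sym eq′) (trans (cong w (slot-tag is-edge)) eq)))) (anc-root a)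

-- The cyclic order of K read off from the holes

module HoleOrder {l : ℕ} {K X : Set} (_≟_ : DecidableEquality (K ⊎ X)) (F : Forest K X)
  (tag : Fin (suc l) → Maybe X) (slot : X → Fin (suc l))
  (tag-slot : ∀ x → tag (slot x) ≡ just x) (slot-tag : ∀ {q x} → tag q ≡ just x → slot x ≡ q)
  (w : Fin (suc l) → K ⊎ X) (w-injective : Injective _≡_ _≡_ w) (b : Fin (suc l)) (root₀ : K)
  (occupant : ∀ {q} → tag q ≡ nothing → ∃ λ u → w q ≡ inj₁ u × u ≢ root₀)
  (occupied : ∀ u → u ≢ root₀ → ∃ λ q → tag q ≡ nothing × w q ≡ inj₁ u)
  where

  open Model _≟_ F tag slot tag-slot slot-tag

  private
    M = suc l
    r = holes b M

  holeAt : ∀ (j : Fin r) → ∃ λ q → tag q ≡ nothing × rank b q ≡ toℕ j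
  holeAt j = rank-surjective b (toℕ j) (toℕ<n j)

  -- K in cyclic order, starting with the held vertex (or the root of its tree).
  order : Fin (suc r) → K
  order zero    = root₀
  order (suc j) = proj₁ (occupant (proj₁ (proj₂ (holeAt j))))

  w-order : ∀ j → w (proj₁ (holeAt j)) ≡ inj₁ (order (suc j))
  w-order j = proj₁ (proj₂ (occupant (proj₁ (proj₂ (holeAt j)))))

  w-hole : ∀ {q} j → tag q ≡ nothing → rank b q ≡ toℕ j → w q ≡ inj₁ (order (suc j))
  w-hole j is-hole eq = trans
    (cong w (rank-injective b is-hole (proj₁ (proj₂ (holeAt j))) (trans eq (sym (proj₂ (proj₂ (holeAt j)))))))
    (w-order j)

  order-injective : Injective _≡_ _≡_ order
  order-injective {zero}  {zero}  eq = refl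
  order-injective {zero}  {suc k} eq = contradiction (sym eq) (proj₂ (proj₂ (occupant (proj₁ (proj₂ (holeAt k))))))
  order-injective {suc j} {zero}  eq = contradiction eq (proj₂ (proj₂ (occupant (proj₁ (proj₂ (holeAt j))))))
  order-injective {suc j} {suc k} eq = cong suc (toℕ-injective (trans (sym (proj₂ (proj₂ (holeAt j))))
    (trans (cong (rank b) (w-injective (trans (w-order j) (trans (cong inj₁ eq) (sym (w-order k))))))
           (proj₂ (proj₂ (holeAt k))))))

  order-surjective : StrictlySurjective _≡_ order
  order-surjective u with inj₁ u ≟ inj₁ root₀
  ... | yes eq = zero , sym (inj₁-injective eq)
  ... | no u≢root with occupied u (u≢root ∘ cong inj₁)
  ...   | q , is-hole , eq = suc j , inj₁-injective (trans (sym (w-hole j is-hole (sym (toℕ-fromℕ< rank<r)))) eq)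
    where
    rank<r : rank b q < r
    rank<r = rank-< b is-hole (dist<N b q)
    j : Fin r
    j = fromℕ< rank<r

  open Cycle (⤖⇒↔ (mk⤖ {to = order} (order-injective , strictlySurjective⇒surjective order-surjective))) public
    renaming (successor to κ; successor-transitive to κ-transitive)

  κ-order : ∀ u p → iterate κ u (suc (holes p M)) ≡ u
  κ-order u p = trans (cong (λ k → iterate κ u (suc k)) (holes-turn p b)) (successor-order u)

  -- The right-hand side unfolds to `holeContent` at the base `b`, the form that `content-unique`
  -- asks for.
  w≡κ^rank : ∀ {q} → tag q ≡ nothing → w q ≡ inj₁ (iterate κ root₀ (suc (rank b q)))
  w≡κ^rank {q} is-hole = begin
    w q                                     ≡⟨ w-hole j is-hole (sym toℕj) ⟩
    inj₁ (order (suc j))                    ≡⟨ cong inj₁ (successor^-zero (suc j)) ⟨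
    inj₁ (iterate κ root₀ (suc (toℕ j)))    ≡⟨ cong (λ k → inj₁ (iterate κ root₀ (suc k))) toℕj ⟩
    inj₁ (iterate κ root₀ (suc (rank b q))) ∎
    where
    open ≡-Reasoning
    rank<r : rank b q < r
    rank<r = rank-< b is-hole (dist<N b q)
    j : Fin r
    j = fromℕ< rank<r
    toℕj : toℕ j ≡ rank b q
    toℕj = toℕ-fromℕ< rank<r

-- Toric promotion follows the walk

module _ {n : ℕ} where

  transpose-left : ∀ (i j : Fin n) → PC.transpose i j i ≡ j
  transpose-left i j with i Fin.≟ i
  ... | yes _  = refl
  ... | no i≢i = contradiction refl i≢i

  transpose-right : ∀ (i j : Fin n) → PC.transpose i j j ≡ i
  transpose-right i j with j Fin.≟ i
  ... | yes j≡i = j≡i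
  ... | no _ with j Fin.≟ j
  ...   | yes _  = refl
  ...   | no j≢j = contradiction refl j≢j

  transpose-other : ∀ {i j k : Fin n} → k ≢ i → k ≢ j → PC.transpose i j k ≡ k
  transpose-other {i} {j} {k} k≢i k≢j with k Fin.≟ i
  ... | yes k≡i = contradiction k≡i k≢i
  ... | no _ with k Fin.≟ j
  ...   | yes k≡j = contradiction k≡j k≢j
  ...   | no _    = refl

bounded : ∀ {n} (f : Fin n → ℕ) → ∃ λ B → ∀ i → f i ≤ B
bounded {zero}  f = 0 , λ ()
bounded {suc n} f with bounded (f ∘ suc)
... | B , f≤B = f zero + B , λ
  { zero    → m≤m+n (f zero) B
  ; (suc i) → m≤n⇒m≤o+n (f zero) (f≤B i) }

-- With `suc (suc l)` vertices the queue is nonempty. The vertex `x₀` provides an edge from K into a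
-- tree, at which a state reveals its pair.
module CliqueWithTrees {l : ℕ} {K X : Set} (finite : (K ⊎ X) ↔ Fin (suc (suc l)))
  (_~_ : K ⊎ X → K ⊎ X → Set) (_~?_ : Decidable _~_)
  (~-sym : Symmetric _~_) (~-irrefl : ∀ {v} → ¬ (v ~ v))
  (F : Forest K X) (up-adj : ∀ x → Forest.up F x ~ inj₂ x)
  (adj-tree : ∀ {h x} → h ~ inj₂ x →
    h ≡ Forest.up F x ⊎ ∃ λ y → h ≡ inj₂ y × Forest.up F y ≡ inj₂ x)
  (clique : ∀ {u w} → u ≢ w → inj₁ u ~ inj₁ w) (x₀ : X)
  where

  open Forest F

  V : Set
  V = K ⊎ X

  M N : ℕ
  M = suc l
  N = suc M

  G : Graph N
  G = record { V = V ; finite = finite ; _~_ = _~_ ; _~?_ = _~?_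
             ; ~-sym = λ {v} {w} → ~-sym {v} {w} ; ~-irrefl = λ {v} → ~-irrefl {v} }

  open Graph G using (_≟ᵥ_)

  at : Labeling G → Fin N → V
  at = Inverse.from

  at-injective : ∀ (σ : Labeling G) → Injective _≡_ _≡_ (at σ)
  at-injective σ {i} {j} eq = trans (sym (Inverse.strictlyInverseˡ σ i))
    (trans (cong (Inverse.to σ) eq) (Inverse.strictlyInverseˡ σ j))

  at-cong : ∀ (σ τ : Labeling G) → Inverse.to σ ≗ Inverse.to τ → at σ ≗ at τ
  at-cong σ τ σ≗τ i = sym (trans (sym (Inverse.strictlyInverseʳ σ (at τ i)))
    (cong (at σ) (trans (σ≗τ (at τ i)) (Inverse.strictlyInverseˡ τ i))))

  to-cong : ∀ (σ τ : Labeling G) → at σ ≗ at τ → Inverse.to σ ≗ Inverse.to τ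
  to-cong σ τ at≗ v = sym (trans (sym (Inverse.strictlyInverseˡ σ (Inverse.to τ v)))
    (cong (Inverse.to σ) (trans (at≗ (Inverse.to τ v)) (Inverse.strictlyInverseʳ τ v))))

  vertexDepth : V → ℕ
  vertexDepth (inj₁ u) = 0
  vertexDepth (inj₂ x) = depth x

  depth-bound : ∃ λ B → ∀ x → depth x ≤ B
  depth-bound with bounded (vertexDepth ∘ Inverse.from finite)
  ... | B , ≤B = B , λ x → subst (λ v → vertexDepth v ≤ B) (Inverse.strictlyInverseʳ finite (inj₂ x))
                              (≤B (Inverse.to finite (inj₂ x)))

  -- States represented by pairs

  module Simulation
    (tag : Fin M → Maybe X) (slot : X → Fin M)
    (tag-slot : ∀ x → tag (slot x) ≡ just x) (slot-tag : ∀ {q x} → tag q ≡ just x → slot x ≡ q)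
    (κ : K → K)
    (κ-order : ∀ u p → iterate κ u (suc (Model.holes _≟ᵥ_ F tag slot tag-slot slot-tag p M)) ≡ u)
    (κ-transitive : ∀ u w → ∃ λ k → iterate κ u k ≡ w)
    where

    open Model _≟ᵥ_ F tag slot tag-slot slot-tag
    open Dynamics κ κ-order
    open Adjacency _~_ (λ {v} {w} → ~-sym {v} {w}) up-adj adj-tree clique
    open Connectivity (proj₁ depth-bound) (proj₂ depth-bound) κ-transitive

    -- Label `i + 1 + k` corresponds to slot `p + k`; labels are cyclic modulo `N`, slots modulo
    -- `M`.
    record Sim (s : State G) (a : V × Fin M) : Set where
      constructor sim
      field
        held  : at (proj₁ s) (proj₂ s) ≡ proj₁ a
        queue : ∀ k → k < M → at (proj₁ s) (iterate next (next (proj₂ s)) k) ≡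
                              content (proj₁ a) (proj₂ a) (iterate next (proj₂ a) k)

    next≢ : ∀ {n} {i : Fin (suc n)} {j k} → j < suc n → k < suc n → j ≢ k → iterate next i j ≢ iterate next i k
    next≢ {i = i} j< k< j≢k eq = j≢k (next^-injective i j< k< eq)

    sim-content : ∀ {σ i h p} → Sim (σ , i) (h , p) → at σ (next i) ≡ content h p p
    sim-content (sim _ eqs) = eqs 0 (s≤s z≤n)

    sim-step : ∀ {σ i h p} → Sim (σ , i) (h , p) → Step h p
    sim-step {σ} {i} {h} {p} S@(sim eq eqs) = step h p
      (λ c≡h → next≢ {i = i} {1} {0} (s≤s (s≤s z≤n)) (s≤s z≤n) (λ ())
        (at-injective σ (trans (sim-content S) (trans c≡h (sym eq)))))
      λ q c≡ → trans (cong (iterate next p) (next^-injective (next i) (s≤s z≤n) (m<n⇒m<1+n (dist<N p q))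
        (at-injective σ (trans (sim-content S) (trans c≡ (trans (cong (content h p) (sym (next^dist p q)))
          (sym (eqs (dist p q) (dist<N p q)))))))))
        (next^dist p q)

    -- In both branches the vertex that ends up with label `i` becomes the last of the queue, in
    -- slot `p`; the others move one place forward.
    TPro-sim : ∀ s x → Sim s x → Sim (TPro G s) (walk x)
    TPro-sim (σ , i) (h , p) S@(sim eq eqs) with sim-step S
    ... | exchange {h′} move≡ h~h′ c≡h′ back same with at σ i ~? at σ (next i)
    ...   | no ¬adj = contradiction (subst₂ _~_ (sym eq) (sym (trans (sim-content S) c≡h′)) h~h′) ¬adj
    ...   | yes _ rewrite move≡ = sim (trans (sim-content S) c≡h′) (λ k k<M → go k (m<1+n⇒m<n∨m≡n k<M))
      where
      go : ∀ k → k < l ⊎ k ≡ l → at σ (iterate next (next (next i)) k) ≡ content h′ (next p) (iterate next (next p) k)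
      go k (inj₁ k<l) = trans (eqs (suc k) (s≤s k<l))
        (sym (same _ (next≢ {i = p} {0} {suc k} (s≤s z≤n) (s≤s k<l) (λ ()))))
      -- The last place of the new queue wraps around to label `i` and to slot `p`.
      go k (inj₂ refl) = trans (cong (at σ) (next^N i))
        (trans eq (sym (trans (cong (content h′ (next p)) (next^N p)) back)))
    TPro-sim (σ , i) (h , p) S@(sim eq eqs) | pass move≡ ¬h~c same with at σ i ~? at σ (next i)
    ...   | yes adj = contradiction (subst₂ _~_ eq (sim-content S) adj) ¬h~c
    -- Inverting the transposition exchanges its two arguments.
    ...   | no _ rewrite move≡ = sim (trans (cong (at σ) (transpose-left (next i) i)) eq)
            (λ k k<M → trans (go k (m<1+n⇒m<n∨m≡n k<M)) (sym (same _)))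
      where
      go : ∀ k → k < l ⊎ k ≡ l → at σ (PC.transpose (next i) i (iterate next (next (next i)) k)) ≡
                                 content h p (iterate next (next p) k)
      go k (inj₁ k<l) = trans (cong (at σ) (transpose-other
          (next≢ {i = i} {suc (suc k)} {1} (s≤s (s≤s k<l)) (s≤s (s≤s z≤n)) (λ ()))
          (next≢ {i = i} {suc (suc k)} {0} (s≤s (s≤s k<l)) (s≤s z≤n) (λ ()))))
        (eqs (suc k) (s≤s k<l))
      go k (inj₂ refl) = trans (cong (at σ) (trans (cong (PC.transpose (next i) i) (next^N i)) (transpose-right (next i) i)))
        (trans (sim-content S) (cong (content h p) (sym (next^N p))))

    TPro^-sim : ∀ s x k → Sim s x → Sim (iterate (TPro G) s k) (iterate walk x k)
    TPro^-sim s x zero    S = S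
    TPro^-sim s x (suc k) S = TPro^-sim (TPro G s) (walk x) k (TPro-sim s x S)

    sim-≈ : ∀ s s′ x → _≈_ G s s′ → Sim s x → Sim s′ x
    sim-≈ (σ , i) (τ , .i) (h , p) (σ≗τ , refl) (sim eq eqs) =
      sim (trans (sym (at≗ i)) eq) (λ k k<M → trans (sym (at≗ _)) (eqs k k<M))
      where
      at≗ = at-cong σ τ σ≗τ

    sim-unique : ∀ s s′ x → Sim s x → Sim s′ x → proj₂ s ≡ proj₂ s′ → _≈_ G s s′
    sim-unique (σ , i) (τ , .i) (h , p) (sim eq eqs) (sim eq′ eqs′) refl = to-cong σ τ at≗ , refl
      where
      at≗ : at σ ≗ at τ
      at≗ j with dist i j | next^dist i j | dist<N i j
      ... | zero  | refl | _    = trans eq (sym eq′)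
      ... | suc k | refl | k<   = trans (eqs k (≤-pred k<)) (sym (eqs′ k (≤-pred k<)))

    pointer-TPro : ∀ s → proj₂ (TPro G s) ≡ next (proj₂ s)
    pointer-TPro (σ , i) with at σ i ~? at σ (next i)
    ... | yes _ = refl
    ... | no _  = refl

    pointer-TPro^ : ∀ s k → proj₂ (iterate (TPro G) s k) ≡ iterate next (proj₂ s) k
    pointer-TPro^ s zero    = refl
    pointer-TPro^ s (suc k) = trans (pointer-TPro^ (TPro G s) k) (cong (λ i → iterate next i k) (pointer-TPro s))

    -- The vertex that a state meets next identifies the slot of a tree edge that
    -- is crossed downwards from K.
    recognise : ∀ {σ i u x a} → up x ≡ inj₁ u → Sim (σ , i) (inj₁ u , slot x) → Sim (σ , i) a → a ≡ (inj₁ u , slot x)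
    recognise {σ} {i} {u} {x} {h , p} up≡ S@(sim eq _) S′@(sim eq′ _) with trans (sym eq′) eq
    ... | refl with tag-view p
    ...   | inj₁ (y , is-edge) = cong (inj₁ u ,_) (trans (sym (slot-tag is-edge)) (cong slot (inj₂-injective
            (trans (sym (content-¬anc {inj₁ u} {p} {p} is-edge λ ())) meets))))
      where
      meets : content (inj₁ u) p p ≡ inj₂ x
      meets = trans (sym (sim-content S′)) (trans (sim-content S)
        (content-¬anc {inj₁ u} {slot x} {slot x} (tag-slot x) λ ()))
    ...   | inj₂ is-hole with () ← trans (sym (content-hole {inj₁ u} {p} {p} is-hole))
            (trans (sym (sim-content S′)) (trans (sim-content S)
              (content-¬anc {inj₁ u} {slot x} {slot x} (tag-slot x) λ ())))

    module _ {L : ℕ} (L≡NM : L ≡ N * M) (states : (V × Fin M) ↔ Fin L) where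

      open SingleOrbit states walk walk-injective single-orbit

      1≤L : 1 ≤ L
      1≤L = subst (1 ≤_) (sym L≡NM) (s≤s z≤n)

      -- Both pairs are iterated until the walk from `a` crosses the top edge above `x₀`; there
      -- `recognise` makes them equal, and injectivity of `walk` carries this back.
      sim-injective : ∀ s a b → Sim s a → Sim s b → b ≡ a
      sim-injective s a b S S′ = go (reachable a L 1≤L (periodic a) (inj₁ (root x₀) , slot (top x₀)))
        where
        go : (∃ λ t → t < L × iterate walk a t ≡ (inj₁ (root x₀) , slot (top x₀))) → b ≡ a
        go (t , _ , eq) = iterate-injective walk walk-injective t (trans
          (recognise (proj₂ (anc-top x₀)) (subst (Sim (iterate (TPro G) s t)) eq (TPro^-sim s a t S))
            (TPro^-sim s b t S′))
          (sym eq))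

      sim-orbit-length : ∀ s a → Sim s a → OrbitLength G s L
      sim-orbit-length s a S = record
        { positive = 1≤L
        ; returns  = sim-unique (iterate (TPro G) s L) s a
            (subst (Sim (iterate (TPro G) s L)) (periodic a) (TPro^-sim s a L S)) S
            -- The label pointer has period `N`, and `L` is the multiple `M * N`.
            (trans (pointer-TPro^ s L) (trans (cong (iterate next (proj₂ s)) (trans L≡NM (*-comm N M)))
              (iterate-periodic next (proj₂ s) N (next^N (proj₂ s)) M)))
        ; least    = λ k 1≤k return → period≥L a k 1≤k
            (sim-injective s a (iterate walk a k) S (sim-≈ (iterate (TPro G) s k) s (iterate walk a k) return (TPro^-sim s a k S)))
        }

  -- A pair for an arbitrary initial state

  module Start (h₀ : V) (w : Fin M → V) (w-injective : Injective _≡_ _≡_ w)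
    (w≢h₀ : ∀ q → w q ≢ h₀) (find : ∀ v → v ≢ h₀ → ∃ λ q → w q ≡ v) where

    open Placement finite _≟ᵥ_ F h₀ zero w w-injective w≢h₀ find
    open Model _≟ᵥ_ F tag slot tag-slot slot-tag using (rootOf; base; module Dynamics)
    open HoleOrder _≟ᵥ_ F tag slot tag-slot slot-tag w w-injective (base h₀ zero) (rootOf h₀) occupant occupied
    open Dynamics κ κ-order using (content-unique)
    open Simulation tag slot tag-slot slot-tag κ κ-order κ-transitive using (sim; sim-orbit-length)

    start-orbit-length : ∀ {L} → L ≡ N * M → (V × Fin M) ↔ Fin L → ∀ s → at (proj₁ s) (proj₂ s) ≡ h₀ →
      (∀ k → k < M → at (proj₁ s) (iterate next (next (proj₂ s)) k) ≡ w (iterate next zero k)) → OrbitLength G s L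
    start-orbit-length L≡NM states s held queue = sim-orbit-length L≡NM states s (h₀ , zero)
      (sim held (λ k k<M → trans (queue k k<M)
        (content-unique {h₀} {zero} w w-slot-anc w-slot-¬anc w≡κ^rank (iterate next zero k))))

  orbit-length : ∀ {L} → L ≡ N * M → ∀ s → OrbitLength G s L
  orbit-length L≡NM s@(σ , i) = start-orbit-length L≡NM (subst (λ L → (V × Fin M) ↔ Fin L) (sym L≡NM)
      (↔-trans (finite ×-↔ ↔-refl) (↔-sym *↔×))) s refl
      λ k k<M → cong (λ j → at σ (iterate next (next i) j)) (sym (dist-next^ zero k<M))
    where
    h₀ : V
    h₀ = at σ i
    -- With the pointer at slot `zero`, slot `k` holds the vertex labelled `i + 1 + k`.
    w : Fin M → V
    w q = at σ (iterate next (next i) (dist zero q))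
    w-injective : Injective _≡_ _≡_ w
    w-injective {q} {q′} eq = trans (sym (next^dist zero q)) (trans (cong (iterate next zero)
      (next^-injective (next i) (m<n⇒m<1+n (dist<N zero q)) (m<n⇒m<1+n (dist<N zero q′)) (at-injective σ eq)))
      (next^dist zero q′))
    w≢h₀ : ∀ q → w q ≢ h₀
    w≢h₀ q eq with next^-injective i (s≤s (dist<N zero q)) (s≤s z≤n) (at-injective σ eq)
    ... | ()
    find : ∀ v → v ≢ h₀ → ∃ λ q → w q ≡ v
    find v v≢h₀ with dist i (Inverse.to σ v) | next^dist i (Inverse.to σ v) | dist<N i (Inverse.to σ v)
    ... | zero  | eq | _  = contradiction (trans (sym (Inverse.strictlyInverseʳ σ v)) (cong (at σ) (sym eq))) v≢h₀
    ... | suc k | eq | k< = iterate next zero k ,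
      trans (cong (λ j → at σ (iterate next (next i) j)) (dist-next^ zero (≤-pred k<)))
        (trans (cong (at σ) eq) (Inverse.strictlyInverseʳ σ v))
    open Start h₀ w w-injective w≢h₀ find

-- The corona

module CoronaForest {m : ℕ} (n : ℕ) (T : Graph m) (tree : IsTree T) (v′ : Graph.V T) where

  open Graph T using (_≟ᵥ_) renaming (V to A; _~_ to _~ᵀ_; ~-sym to ~ᵀ-sym)
  open Rooted T tree v′
  open Corona (complete n) T v′ using (Vertex; Adj; adj?; adj-sym; adj-irrefl)

  up : Fin n × A → Fin n ⊎ (Fin n × A)
  up (u , a) with a ≟ᵥ v′
  ... | yes _ = inj₁ u
  ... | no _  = inj₂ (u , parent a)

  up-root : ∀ u → up (u , v′) ≡ inj₁ u
  up-root u with v′ ≟ᵥ v′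
  ... | yes _ = refl
  ... | no ≢  = contradiction refl ≢

  up-above : ∀ u {a} → a ≢ v′ → up (u , a) ≡ inj₂ (u , parent a)
  up-above u {a} a≢v′ with a ≟ᵥ v′
  ... | yes a≡v′ = contradiction a≡v′ a≢v′
  ... | no _     = refl

  forest : Forest (Fin n) (Fin n × A)
  forest = record
    { up        = up
    ; depth     = λ (_ , a) → depth a
    ; depth-up  = λ {x} {y} → depth-up {x} {y}
    ; root      = proj₁
    ; root-inj₁ = λ {x} → root-inj₁ {x}
    ; root-inj₂ = λ {x} → root-inj₂ {x}
    ; top       = λ (u , _) → u , v′
    ; top-inj₁  = λ {x} → top-inj₁ {x}
    ; top-inj₂  = λ {x} eq → cong (_, v′) (root-inj₂ {x} eq)
    }
    where
    depth-up : ∀ {x y} → up x ≡ inj₂ y → depth (proj₂ y) < depth (proj₂ x)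
    depth-up {u , a} eq with a ≟ᵥ v′
    depth-up {u , a} refl | no a≢v′ = depth-parent a≢v′
    root-inj₁ : ∀ {x u} → up x ≡ inj₁ u → proj₁ x ≡ u
    root-inj₁ {u , a} eq with a ≟ᵥ v′
    root-inj₁ {u , a} refl | yes _ = refl
    root-inj₂ : ∀ {x y} → up x ≡ inj₂ y → proj₁ x ≡ proj₁ y
    root-inj₂ {u , a} eq with a ≟ᵥ v′
    root-inj₂ {u , a} refl | no _ = refl
    top-inj₁ : ∀ {x u} → up x ≡ inj₁ u → (proj₁ x , v′) ≡ x
    top-inj₁ {u , a} eq with a ≟ᵥ v′
    ... | yes refl = refl

  up-adj : ∀ x → Adj (up x) (inj₂ x)
  up-adj (u , a) with a ≟ᵥ v′
  ... | yes a≡v′ = refl , a≡v′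
  ... | no a≢v′  = refl , ~ᵀ-sym (parent-adj a≢v′)

  adj-tree : ∀ {h x} → Adj h (inj₂ x) → h ≡ up x ⊎ ∃ λ y → h ≡ inj₂ y × up y ≡ inj₂ x
  adj-tree {inj₁ u} {.u , .v′} (refl , refl) = inj₁ (sym (up-root u))
  adj-tree {inj₂ (u , b)} {.u , a} (refl , b~a) with adj⇒parent b~a
  ... | inj₁ (b≢v′ , refl) = inj₂ ((u , b) , refl , up-above u b≢v′)
  ... | inj₂ (a≢v′ , refl) = inj₁ (sym (up-above u a≢v′))

  resize : ∀ {N} → Vertex ↔ Fin N → Graph N
  resize finite = record
    { V = Vertex ; finite = finite ; _~_ = Adj ; _~?_ = adj?
    ; ~-sym = λ {p} {q} → adj-sym {p} {q} ; ~-irrefl = λ {p} → adj-irrefl {p} }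

  -- The corona with the number of vertices turned into a variable, so that it
  -- can be matched against suc (suc l).
  orbit-length : ∀ {N} (finite : Vertex ↔ Fin N) → 2 ≤ N → Fin n × A →
    ∀ {L} → L ≡ N * (N ∸ 1) → ∀ s → OrbitLength (resize finite) s L
  orbit-length finite (s≤s (s≤s _)) x₀ =
    CliqueWithTrees.orbit-length finite Adj adj? (λ {p} {q} → adj-sym {p} {q}) (λ {p} → adj-irrefl {p})
      forest up-adj (λ {h} → adj-tree {h}) (λ u≢w → u≢w) x₀

theorem10 : (m n : ℕ) → 1 ≤ m → 1 ≤ n →
    (T : Graph m) → IsTree T → (v′ : Graph.V T) →
    let G = complete n ⊙ T ⟨ v′ ⟩ in
    (s : State G) → OrbitLength G s ((n * m + n) * (n * m + n ∸ 1))
theorem10 m n 1≤m 1≤n T tree v′ =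
  -- Two vertices exist since `1 ≤ n` and `1 ≤ n * m`; the copy of `v′` at the first clique vertex
  -- serves as `x₀`.
  orbit-length (Graph.finite (complete n ⊙ T ⟨ v′ ⟩)) (+-mono-≤ 1≤n (*-mono-≤ 1≤n 1≤m)) (first 1≤n , v′)
    -- The corona counts its vertices as `n + n * m`.
    (cong (λ N → N * (N ∸ 1)) (+-comm (n * m) n))
  where
  open CoronaForest n T tree v′
  first : ∀ {n} → 1 ≤ n → Fin n
  first (s≤s _) = zero
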